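{- For every $\boldsymbol{\Delta}^0_3$ set $A\subseteq 2^\omega$ there exist an open set $U$ and a closed set $C$ (subsets of $2^\omega$) such that $\Phi(U)=\Phi(C)\equiv_W A$.
   Context: $2^\omega$ is the Cantor space; $N_s=\{x: s\subset x\}$; $\mu$ is the coin-tossing measure with $\mu(N_s)=2^{ -\mathrm{lh}(s)}$. For measurable $A$, $\Phi(A)=\{x: \lim_{n}\mu(A\cap N_{x\restriction n})/\mu(N_{x\restriction n})=1\}$. $\boldsymbol{\Delta}^0_3$ denotes the sets that are both $F_{\sigma\delta}$ and $G_{\delta\sigma}$. For $X,Y\subseteq 2^\omega$, $X\le_W Y$ (Wadge reducibility) means $X=f^{ -1}(Y)$ for some continuous $f:2^\omega\to2^\omega$, and $X\equiv_W Y$ means $X\le_W Y$ and $Y\le_W X$. -}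

module Defs where

open import Data.Bool.Base using (Bool)
open import Data.List.Base using (List; []; _∷_; length; map; foldr; applyUpTo)
open import Data.Nat.Base as ℕ using (ℕ)
open import Data.Product.Base using (Σ-syntax; ∃-syntax; _×_)
open import Data.Rational.Base using (ℚ; 0ℚ; 1ℚ; ½; _+_; _-_; _*_; _≤_; _<_)
open import Level using (0ℓ)
open import Relation.Binary.PropositionalEquality.Core using (_≡_)
open import Relation.Nullary.Negation.Core using (¬_)
open import Relation.Unary using (Pred; _⊆_; _≐_; _∩_; ∁; ⋃; ⋂; _⊢_)

-- Points of 2^ω are compared pointwise.  Without function extensionality a
-- Pred on Cantor need not respect pointwise equality, but open sets always
-- do, by definition; under excluded middle so does every set built from them
-- by complements and countable unions and intersections.

Cantor : Set
Cantor = ℕ → Bool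

_↾_ : Cantor → ℕ → List Bool
x ↾ n = applyUpTo x n

N : List Bool → Pred Cantor 0ℓ
N s x = x ↾ length s ≡ s

IsOpen : Pred Cantor 0ℓ → Set
IsOpen U = ∀ {x} → U x → ∃[ n ] N (x ↾ n) ⊆ U

IsClosed : Pred Cantor 0ℓ → Set
IsClosed C = IsOpen (∁ C)

IsFσ IsGδ IsFσδ IsGδσ IsΔ⁰₃ : Pred Cantor 0ℓ → Set₁
IsFσ  A = Σ[ F ∈ (ℕ → Pred Cantor 0ℓ) ] (∀ n → IsClosed (F n)) × A ≐ ⋃ ℕ F
IsGδ  A = Σ[ G ∈ (ℕ → Pred Cantor 0ℓ) ] (∀ n → IsOpen   (G n)) × A ≐ ⋂ ℕ G
IsFσδ A = Σ[ F ∈ (ℕ → Pred Cantor 0ℓ) ] (∀ n → IsFσ     (F n)) × A ≐ ⋂ ℕ F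
IsGδσ A = Σ[ G ∈ (ℕ → Pred Cantor 0ℓ) ] (∀ n → IsGδ     (G n)) × A ≐ ⋃ ℕ G
IsΔ⁰₃ A = IsFσδ A × IsGδσ A

Continuous : (Cantor → Cantor) → Set₁
Continuous f = ∀ {V} → IsOpen V → IsOpen (f ⊢ V)

infix 4 _≤W_ _≡W_

_≤W_ _≡W_ : Pred Cantor 0ℓ → Pred Cantor 0ℓ → Set₁
X ≤W Y = Σ[ f ∈ (Cantor → Cantor) ] Continuous f × X ≐ f ⊢ Y
X ≡W Y = X ≤W Y × Y ≤W X

-- A real number r is represented by the set of rationals q with r < q.

Real : Set₁
Real = Pred ℚ 0ℓ

infix 4 _<ʳ_ _ʳ<_

_<ʳ_ : Real → ℚ → Set
r <ʳ q = r q

_ʳ<_ : ℚ → Real → Set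
q ʳ< r = ∃[ p ] q < p × ¬ (r <ʳ p)

-- Division by a rational c, meaningful for c > 0:  r / c < q  iff  r < q c.

_/ʳ_ : Real → ℚ → Real
(r /ʳ c) q = r <ʳ q * c

Lim : (ℕ → Real) → ℚ → Set
Lim r l = ∀ ε → 0ℚ < ε →
  ∃[ k ] (∀ n → k ℕ.≤ n → (l - ε) ʳ< r n × r n <ʳ (l + ε))

-- The value 2^(- lh s) of the coin-tossing measure on N s.

μN : List Bool → ℚ
μN []      = 1ℚ
μN (_ ∷ s) = ½ * μN s

partialSum : (ℕ → List Bool) → ℕ → ℚ
partialSum c k = foldr _+_ 0ℚ (map μN (applyUpTo c k))

-- The coin-tossing measure, as the outer measure it induces on all subsets:
-- the infimum of Σᵢ μN (c i) over all sequences c whose basic sets cover A.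
-- On measurable sets, in particular on open and on closed ones, it is the
-- measure itself.  The infimum is < q  iff  for some cover all the partial
-- sums are bounded by a single p < q.

μ : Pred Cantor 0ℓ → Real
μ A q = Σ[ c ∈ (ℕ → List Bool) ]
  A ⊆ ⋃ ℕ (λ i → N (c i)) × ∃[ p ] p < q × (∀ k → partialSum c k ≤ p)

Φ : Pred Cantor 0ℓ → Pred Cantor 0ℓ
Φ A x = Lim (λ n → μ (A ∩ N (x ↾ n)) /ʳ μN (x ↾ n)) 1ℚ

{-# OPTIONS --safe #-}

-- Write A = ⋂ₙ ⋃ₘ K n m with K n m closed.  Guessing for each n some m with
-- y ∈ K n m, and revising a guess when a finite prefix of y refutes it,
-- assigns a level to every prefix of y, falling by at most one per bit, such
-- that y ∈ A iff the level tends to infinity.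
--
-- Code y as the sequence encode y = 0 0 y₀ 0 0 y₁ …; the codes form a closed
-- null set.  Of the two cones branching off the codes at a prefix t of level ℓ,
-- the first is coloured bad in proportion 2^(- ℓ) and good elsewhere; the second
-- is good if ℓ > 0 and bad if ℓ = 0.  Let U be the union of the good parts and C
-- the complement of the union of the bad ones.  As the level falls slowly, the
-- density of U and C at encode y tends to 1 iff the level tends to infinity
-- along y, i.e. iff y ∈ A, so encode reduces A to Φ U = Φ C.
--
-- Conversely decode the codes, and send good parts to points of A and bad parts
-- to points outside A, as close to the decoded prefix t as possible.  This is
-- continuous because t is exempted, with nothing bad there, when all its
-- extensions are in A, while below prefixes with no extension in A the level
-- falls to 0 and everything is bad.
module Submission where

open import Defs
open import Axiom.ExcludedMiddle using (ExcludedMiddle)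
open import Data.Bool.Base using (Bool; true; false; not; if_then_else_)
import Data.Bool.Properties as Bool
import Data.Integer.Base as ℤ
import Data.Integer.Properties as ℤ
open import Data.List.Base
  using (List; []; _∷_; _++_; _∷ʳ_; length; map; foldr; foldl; applyUpTo; applyDownFrom; replicate; reverse)
open import Data.List.Properties
  using (∷-injectiveˡ; ∷-injectiveʳ; ++-assoc; ++-identityʳ; length-++; length-replicate; length-reverse;
         length-applyUpTo; length-applyDownFrom; applyUpTo-∷ʳ; foldl-++; foldl-∷ʳ;
         reverse-involutive; reverse-applyUpTo; reverse-applyDownFrom)
open import Data.Nat.Base as ℕ using (ℕ; zero; suc; pred; z≤n; s≤s)
open import Data.Nat.Coprimality using (1-coprimeTo)
import Data.Nat.Properties as ℕ
open import Data.Product.Base using (Σ-syntax; ∃; ∃-syntax; _×_; _,_; -,_; proj₁; proj₂; uncurry)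
open import Data.Rational.Base
  using (ℚ; mkℚ; 0ℚ; 1ℚ; ½; _+_; _-_; -_; _*_; _≤_; _<_; *≤*; *<*; toℚᵘ; positive; nonNegative)
open import Data.Rational.Properties
open import Data.Rational.Solver using (module +-*-Solver)
import Data.Rational.Unnormalised.Base as ℚᵘ
import Data.Rational.Unnormalised.Properties as ℚᵘ
open import Data.Sum.Base using (_⊎_; inj₁; inj₂)
open import Data.Unit.Base using (⊤; tt)
open import Function.Base using (_∘_)
open import Level using (0ℓ)
open import Relation.Binary.PropositionalEquality
open import Relation.Nullary.Decidable using (dec-true; dec-false; decidable-stable)
open import Relation.Nullary.Decidable.Core using (yes; no; does)
open import Relation.Nullary.Negation.Core using (¬_; contradiction)
open import Relation.Unary using (Pred; _⊆_; _≐_; _∩_)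
open +-*-Solver using (solve; _:+_; _:*_; _:-_; con; _:=_)

-- Powers of one half and of two, and rational inequalities.

½^_ 2^_ : ℕ → ℚ
½^ zero  = 1ℚ
½^ suc n = ½ * ½^ n
2^ zero  = 1ℚ
2^ suc n = 2^ n + 2^ n

½p+½p≡p : ∀ p → ½ * p + ½ * p ≡ p
½p+½p≡p = solve 1 (λ p → con ½ :* p :+ con ½ :* p := p) refl

½-positive : ∀ {p} → 0ℚ < p → 0ℚ < ½ * p
½-positive 0<p = *-monoʳ-<-pos ½ 0<p

½^-positive : ∀ n → 0ℚ < ½^ n
½^-positive zero    = positive⁻¹ 1ℚ
½^-positive (suc n) = ½-positive (½^-positive n)

½p≤p : ∀ {p} → 0ℚ ≤ p → ½ * p ≤ p
½p≤p {p} 0≤p = begin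
  ½ * p          ≡⟨ +-identityʳ _ ⟨
  ½ * p + 0ℚ     ≤⟨ +-monoʳ-≤ (½ * p) (*-monoˡ-≤-nonNeg ½ 0≤p) ⟩
  ½ * p + ½ * p  ≡⟨ ½p+½p≡p p ⟩
  p              ∎
  where open ≤-Reasoning

½^-antitone : ∀ {m n} → m ℕ.≤ n → ½^ n ≤ ½^ m
½^-antitone {n = zero}  ℕ.z≤n       = ≤-refl
½^-antitone {n = suc n} ℕ.z≤n       =
  ≤-trans (½p≤p (<⇒≤ (½^-positive n))) (½^-antitone {n = n} ℕ.z≤n)
½^-antitone             (ℕ.s≤s m≤n) = *-monoˡ-≤-nonNeg ½ (½^-antitone m≤n)

½^*2^≡1 : ∀ n → ½^ n * 2^ n ≡ 1ℚ
½^*2^≡1 zero    = refl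
½^*2^≡1 (suc n) = trans
  (solve 2 (λ h t → con ½ :* h :* (t :+ t) := h :* t) refl (½^ n) (2^ n))
  (½^*2^≡1 n)

2^-positive : ∀ n → 0ℚ < 2^ n
2^-positive zero    = positive⁻¹ 1ℚ
2^-positive (suc n) = +-mono-< (2^-positive n) (2^-positive n)

1/1+_ : ℕ → ℚ
1/1+ n = mkℚ (ℤ.+ 1) n (1-coprimeTo (suc n))

½^≤1/1+n : ∀ n → ½^ n ≤ 1/1+ n
½^≤1/1+n zero    = ≤-refl
½^≤1/1+n (suc n) = ≤-trans (*-monoˡ-≤-nonNeg ½ (½^≤1/1+n n)) (toℚᵘ-cancel-≤ (begin
  toℚᵘ (½ * 1/1+ n)                 ≃⟨ toℚᵘ-homo-* ½ (1/1+ n) ⟩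
  toℚᵘ ½ ℚᵘ.* ℚᵘ.mkℚᵘ (ℤ.+ 1) n     ≤⟨ ℚᵘ.*≤* (ℤ.*-monoˡ-≤-nonNeg (ℤ.+ 1) (ℤ.+≤+
    (ℕ.s≤s (ℕ.≤-trans (ℕ.≤-reflexive (sym (ℕ.+-comm n 1))) (ℕ.+-monoʳ-≤ n (ℕ.s≤s ℕ.z≤n)))))) ⟩
  ℚᵘ.mkℚᵘ (ℤ.+ 1) (suc n)           ∎))
  where open ℚᵘ.≤-Reasoning

½^-archimedean : ∀ {ε} → 0ℚ < ε → ∃[ n ] ½^ n ≤ ε
-- A positive numerator is at least 1, so `ε` is at least `1/1+ d`.
½^-archimedean {mkℚ (ℤ.+ suc a) d _} _ = d , ≤-trans (½^≤1/1+n d)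
  (*≤* (ℤ.*-monoʳ-≤-nonNeg (ℤ.+ suc d) {ℤ.+ 1} {ℤ.+ suc a} (ℤ.+≤+ (ℕ.s≤s ℕ.z≤n))))
½^-archimedean {mkℚ (ℤ.+ zero) d _} (*<* (ℤ.+<+ ()))
½^-archimedean {mkℚ ℤ.-[1+ a ] d _} (*<* ())

0≤q-p : ∀ {p q} → p ≤ q → 0ℚ ≤ q - p
0≤q-p {p} {q} p≤q = subst (_≤ q - p) (+-inverseʳ p) (+-monoˡ-≤ (- p) p≤q)

0<q-p : ∀ {p q} → p < q → 0ℚ < q - p
0<q-p {p} {q} p<q = subst (_< q - p) (+-inverseʳ p) (+-monoˡ-< (- p) p<q)

<⇒≱ : ∀ {p q} → p < q → ¬ (q ≤ p)
<⇒≱ p<q q≤p = <-irrefl refl (<-≤-trans p<q q≤p)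

p-q<p : ∀ p {q} → 0ℚ < q → p - q < p
p-q<p p {q} 0<q = subst (p - q <_) (+-identityʳ p) (+-monoʳ-< p (neg-antimono-< 0<q))

p-q≤p : ∀ p {q} → 0ℚ ≤ q → p - q ≤ p
p-q≤p p {q} 0≤q = subst (p - q ≤_) (+-identityʳ p) (+-monoʳ-≤ p (neg-antimono-≤ 0≤q))

-- Cylinders and their measure.

N-∷ʳ : ∀ {s x} → N s x → N (s ∷ʳ x (length s)) x
N-∷ʳ {s} {x} x∈Ns = begin
  x ↾ length (s ∷ʳ x (length s))       ≡⟨ cong (x ↾_) (trans (length-++ s) (ℕ.+-comm (length s) 1)) ⟩
  x ↾ suc (length s)                   ≡⟨ applyUpTo-∷ʳ x (length s) ⟨
  x ↾ length s ∷ʳ x (length s)         ≡⟨ cong (_∷ʳ x (length s)) x∈Ns ⟩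
  s ∷ʳ x (length s)                    ∎
  where open ≡-Reasoning

μN-positive : ∀ s → 0ℚ < μN s
μN-positive []      = positive⁻¹ 1ℚ
μN-positive (_ ∷ s) = ½-positive (μN-positive s)

*μN-mono-< : ∀ s {p q} → p < q → p * μN s < q * μN s
*μN-mono-< s = *-monoˡ-<-pos (μN s) {{positive (μN-positive s)}}

*μN-mono-≤ : ∀ s {p q} → p ≤ q → p * μN s ≤ q * μN s
*μN-mono-≤ s = *-monoʳ-≤-nonNeg (μN s) {{nonNegative (<⇒≤ (μN-positive s))}}

*μN-nonneg : ∀ s {p} → 0ℚ ≤ p → 0ℚ ≤ p * μN s
*μN-nonneg s {p} 0≤p = subst (_≤ p * μN s) (*-zeroˡ (μN s)) (*μN-mono-≤ s 0≤p)

*μN-positive : ∀ s {p} → 0ℚ < p → 0ℚ < p * μN s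
*μN-positive s {p} 0<p = subst (_< p * μN s) (*-zeroˡ (μN s)) (*μN-mono-< s 0<p)

μN-nonneg : ∀ s → 0ℚ ≤ μN s
μN-nonneg s = <⇒≤ (μN-positive s)

μN≤1 : ∀ s → μN s ≤ 1ℚ
μN≤1 []      = ≤-refl
μN≤1 (_ ∷ s) = ≤-trans (½p≤p (μN-nonneg s)) (μN≤1 s)

μN-∷ʳ : ∀ s b → μN (s ∷ʳ b) ≡ ½ * μN s
μN-∷ʳ []      b = refl
μN-∷ʳ (_ ∷ s) b = cong (½ *_) (μN-∷ʳ s b)

μN-split : ∀ s → μN s ≡ μN (s ∷ʳ false) + μN (s ∷ʳ true)
μN-split s = sym (trans (cong₂ _+_ (μN-∷ʳ s false) (μN-∷ʳ s true)) (½p+½p≡p (μN s)))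

μN-replicate : ∀ n b → μN (replicate n b) ≡ ½^ n
μN-replicate zero    b = refl
μN-replicate (suc n) b = cong (½ *_) (μN-replicate n b)

-- Partial sums over covers.

∑ : (List Bool → ℚ) → (ℕ → List Bool) → ℕ → ℚ
∑ f c k = foldr _+_ 0ℚ (map f (applyUpTo c k))

∑-mono : ∀ {f g} → (∀ s → f s ≤ g s) → ∀ c k → ∑ f c k ≤ ∑ g c k
∑-mono f≤g c zero    = ≤-refl
∑-mono f≤g c (suc k) = +-mono-≤ (f≤g (c 0)) (∑-mono f≤g (c ∘ suc) k)

∑-+ : ∀ {f g h} → (∀ s → f s ≡ g s + h s) → ∀ c k → ∑ f c k ≡ ∑ g c k + ∑ h c k
∑-+ f≡g+h c zero    = refl
∑-+ {f} {g} {h} f≡g+h c (suc k) = trans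
  (cong₂ _+_ (f≡g+h (c 0)) (∑-+ {f} {g} {h} f≡g+h (c ∘ suc) k))
  (solve 4 (λ a b p q → (a :+ b) :+ (p :+ q) := (a :+ p) :+ (b :+ q)) refl
    (g (c 0)) (h (c 0)) (∑ g (c ∘ suc) k) (∑ h (c ∘ suc) k))

module _ {f : List Bool → ℚ} (0≤f : ∀ s → 0ℚ ≤ f s) where

  ∑-nonneg : ∀ c k → 0ℚ ≤ ∑ f c k
  ∑-nonneg c zero    = ≤-refl
  ∑-nonneg c (suc k) = +-mono-≤ (0≤f (c 0)) (∑-nonneg (c ∘ suc) k)

  ∑-monoʳ : ∀ c {k l} → k ℕ.≤ l → ∑ f c k ≤ ∑ f c l
  ∑-monoʳ c {l = l} ℕ.z≤n = ∑-nonneg c l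
  ∑-monoʳ c (ℕ.s≤s k≤l)   = +-monoʳ-≤ (f (c 0)) (∑-monoʳ (c ∘ suc) k≤l)

  term≤∑ : ∀ c i → f (c i) ≤ ∑ f c (suc i)
  term≤∑ c zero    = ≤-reflexive (sym (+-identityʳ _))
  term≤∑ c (suc i) = ≤-trans (term≤∑ (c ∘ suc) i)
    (≤-trans (≤-reflexive (sym (+-identityˡ _))) (+-monoˡ-≤ _ (0≤f (c 0))))

-- Upper bounds on the measure from explicit covers.

-- Covers have to be infinite sequences, so a finite one is completed by the
-- cylinders below u at 0, 00, 000, …

padding : List Bool → ℕ → List Bool
padding u zero    = u ∷ʳ false
padding u (suc i) = padding (u ∷ʳ false) i

padding-sum : ∀ u k → partialSum (padding u) k ≤ μN u
padding-sum u zero    = μN-nonneg u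
padding-sum u (suc k) = begin
  μN (u ∷ʳ false) + partialSum (padding (u ∷ʳ false)) k  ≤⟨ +-monoʳ-≤ (μN (u ∷ʳ false)) (padding-sum (u ∷ʳ false) k) ⟩
  μN (u ∷ʳ false) + μN (u ∷ʳ false)                      ≡⟨ cong₂ _+_ (μN-∷ʳ u false) (μN-∷ʳ u false) ⟩
  ½ * μN u + ½ * μN u                                    ≡⟨ ½p+½p≡p (μN u) ⟩
  μN u                                                   ∎
  where open ≤-Reasoning

_◂_ : List Bool → (ℕ → List Bool) → ℕ → List Bool
(s ◂ c) zero    = s
(s ◂ c) (suc i) = c i

-- Covers N s ∖ N (s ++ u) by the siblings of the nodes between s and s ++ u.
avoiding : List Bool → List Bool → ℕ → List Bool
avoiding s []      = padding (s ∷ʳ false)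
avoiding s (b ∷ u) = (s ∷ʳ not b) ◂ avoiding (s ∷ʳ b) u

-- The siblings add up to `μN s - μN (s ++ u)`, and the padding below `(s ++ u) ∷ʳ false` costs at
-- most half of `μN (s ++ u)`; hence the exponent `suc (length u)` instead of `length u`.
avoiding-sum : ∀ s u k → partialSum (avoiding s u) k ≤ (1ℚ - ½^ suc (length u)) * μN s
avoiding-sum s [] k = ≤-trans (padding-sum (s ∷ʳ false) k) (≤-reflexive (μN-∷ʳ s false))
avoiding-sum s (b ∷ u) zero = 
  *μN-nonneg s (0≤q-p (½^-antitone {n = suc (length (b ∷ u))} ℕ.z≤n))
avoiding-sum s (b ∷ u) (suc k) = begin
  μN (s ∷ʳ not b) + partialSum (avoiding (s ∷ʳ b) u) k
    ≤⟨ +-monoʳ-≤ (μN (s ∷ʳ not b)) (avoiding-sum (s ∷ʳ b) u k) ⟩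
  μN (s ∷ʳ not b) + (1ℚ - h) * μN (s ∷ʳ b)
    ≡⟨ cong₂ (λ p q → p + (1ℚ - h) * q) (μN-∷ʳ s (not b)) (μN-∷ʳ s b) ⟩
  ½ * μN s + (1ℚ - h) * (½ * μN s)
    ≡⟨ solve 2 (λ h m → con ½ :* m :+ (con 1ℚ :- h) :* (con ½ :* m) := (con 1ℚ :- con ½ :* h) :* m) refl h (μN s) ⟩
  (1ℚ - ½ * h) * μN s
    ∎
  where
  open ≤-Reasoning
  h : ℚ
  h = ½^ suc (length u)

avoiding-covers : ∀ s u {x} → N s x → ¬ N (s ++ u) x → ∃[ i ] N (avoiding s u i) x
avoiding-covers s [] {x} x∈Ns x∉Nsu =
  contradiction (subst (λ t → N t x) (sym (++-identityʳ s)) x∈Ns) x∉Nsu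
avoiding-covers s (b ∷ u) {x} x∈Ns x∉Nsu with x (length s) Bool.≟ b
... | yes eq =
  let i , x∈Nᵢ = avoiding-covers (s ∷ʳ b) u
        (subst (λ a → N (s ∷ʳ a) x) eq (N-∷ʳ {s} x∈Ns))
        (x∉Nsu ∘ subst (λ t → N t x) (++-assoc s (b ∷ []) u))
  in suc i , x∈Nᵢ
... | no neq = 0 , subst (λ a → N (s ∷ʳ a) x) (Bool.¬-not neq) (N-∷ʳ {s} x∈Ns)

μ-upper : ∀ {B : Pred Cantor 0ℓ} s u {q} → (∀ {x} → B x → ¬ N (s ++ u) x) →
          1ℚ - ½^ suc (length u) < q → μ (B ∩ N s) <ʳ q * μN s
μ-upper s u B⊆ lt =
  avoiding s u ,
  (λ (Bx , x∈Ns) → avoiding-covers s u x∈Ns (B⊆ Bx)) ,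
  _ , *μN-mono-< s lt , avoiding-sum s u

-- This settles the upper half of the limit in `Φ` for every set, so only lower bounds on densities
-- remain to be studied.
μ<1+ε : ∀ (B : Pred Cantor 0ℓ) s {ε} → 0ℚ < ε → μ (B ∩ N s) <ʳ (1ℚ + ε) * μN s
μ<1+ε B s {ε} 0<ε with ½^-archimedean (½-positive (*μN-positive s 0<ε))
... | n , ½^n≤ =
  s ◂ padding (replicate n false) ,
  (λ (_ , x∈Ns) → 0 , x∈Ns) ,
  -- The padding gets only half of the tolerance, as the bound on the partial sums must lie strictly
  -- below the target.
  μN s + ½ * (ε * μN s) ,
  (begin-strict
    μN s + ½ * (ε * μN s)
      ≡⟨ +-identityʳ _ ⟨
    μN s + ½ * (ε * μN s) + 0ℚ
      <⟨ +-monoʳ-< (μN s + ½ * (ε * μN s)) (½-positive (*μN-positive s 0<ε)) ⟩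
    μN s + ½ * (ε * μN s) + ½ * (ε * μN s)
      ≡⟨ solve 2 (λ e m → m :+ con ½ :* (e :* m) :+ con ½ :* (e :* m) := (con 1ℚ :+ e) :* m) refl ε (μN s) ⟩
    (1ℚ + ε) * μN s
      ∎) ,
  λ where
    zero    → ≤-trans (μN-nonneg s) (≤-trans (≤-reflexive (sym (+-identityʳ _)))
                (+-monoʳ-≤ (μN s) (≤-trans (<⇒≤ (½^-positive n)) ½^n≤)))
    (suc k) → +-monoʳ-≤ (μN s) (≤-trans (padding-sum (replicate n false) k)
                (≤-trans (≤-reflexive (μN-replicate n false)) ½^n≤))
  where open ≤-Reasoning

-- Lower bounds on the measure from submartingales.

-- ν c t is the measure of N c ∩ N t.
ν : List Bool → List Bool → ℚ
ν []      t       = μN t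
ν (a ∷ c) []      = μN (a ∷ c)
ν (a ∷ c) (b ∷ t) = if does (a Bool.≟ b) then ½ * ν c t else 0ℚ

ν-[]ʳ : ∀ c → ν c [] ≡ μN c
ν-[]ʳ []      = refl
ν-[]ʳ (_ ∷ c) = refl

ν-nonneg : ∀ t c → 0ℚ ≤ ν c t
ν-nonneg t       []      = μN-nonneg t
ν-nonneg []      (a ∷ c) = μN-nonneg (a ∷ c)
ν-nonneg (b ∷ t) (a ∷ c) with does (a Bool.≟ b)
... | true  = *-monoˡ-≤-nonNeg ½ (ν-nonneg t c)
... | false = ≤-refl

ν≤μN : ∀ t c → ν c t ≤ μN c
ν≤μN t       []      = μN≤1 t
ν≤μN []      (a ∷ c) = ≤-refl
ν≤μN (b ∷ t) (a ∷ c) with does (a Bool.≟ b)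
... | true  = *-monoˡ-≤-nonNeg ½ (ν≤μN t c)
... | false = μN-nonneg (a ∷ c)

ν-split : ∀ t c → ν c t ≡ ν c (t ∷ʳ false) + ν c (t ∷ʳ true)
ν-split t       []          = μN-split t
ν-split []      (false ∷ c) = sym (trans (+-identityʳ _) (cong (½ *_) (ν-[]ʳ c)))
ν-split []      (true  ∷ c) = sym (trans (+-identityˡ _) (cong (½ *_) (ν-[]ʳ c)))
ν-split (b ∷ t) (a ∷ c) with does (a Bool.≟ b)
... | true  = trans (cong (½ *_) (ν-split t c)) (*-distribˡ-+ ½ (ν c (t ∷ʳ false)) (ν c (t ∷ʳ true)))
... | false = refl

ν-↾ : ∀ x {m n} → m ℕ.≤ n → ν (x ↾ m) (x ↾ n) ≡ μN (x ↾ n)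
ν-↾ x ℕ.z≤n       = refl
ν-↾ x (ℕ.s≤s m≤n) rewrite dec-true (x 0 Bool.≟ x 0) refl = cong (½ *_) (ν-↾ (x ∘ suc) m≤n)

_⧺_ : List Bool → Cantor → Cantor
([] ⧺ z)      n       = z n
((b ∷ s) ⧺ z) zero    = b
((b ∷ s) ⧺ z) (suc n) = (s ⧺ z) n

⧺-↾ : ∀ s z n → (s ⧺ z) ↾ (length s ℕ.+ n) ≡ s ++ (z ↾ n)
⧺-↾ []      z n = refl
⧺-↾ (b ∷ s) z n = cong (b ∷_) (⧺-↾ s z n)

branch : ∀ {P : List Bool → Set} → (∀ t → P t → ∃[ b ] P (t ∷ʳ b)) →
         ∀ s → P s → ∃[ x ] N s x × (∀ n → P (x ↾ (length s ℕ.+ n)))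
branch {P} next s Ps = s ⧺ z , x∈Ns , λ n → subst P (trans (node≡ n) (sym (⧺-↾ s z n))) (proj₂ (node n))
  where
  node : ℕ → ∃ P
  node zero    = s , Ps
  node (suc n) = -, proj₂ (uncurry next (node n))
  z : Cantor
  z n = proj₁ (uncurry next (node n))
  node≡ : ∀ n → proj₁ (node n) ≡ s ++ (z ↾ n)
  node≡ zero    = sym (++-identityʳ s)
  node≡ (suc n) = begin
    proj₁ (node n) ∷ʳ z n     ≡⟨ cong (_∷ʳ z n) (node≡ n) ⟩
    (s ++ (z ↾ n)) ∷ʳ z n     ≡⟨ ++-assoc s (z ↾ n) (z n ∷ []) ⟩
    s ++ ((z ↾ n) ∷ʳ z n)     ≡⟨ cong (s ++_) (applyUpTo-∷ʳ z n) ⟩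
    s ++ (z ↾ suc n)          ∎
    where open ≡-Reasoning
  x∈Ns : N s (s ⧺ z)
  x∈Ns = trans (cong ((s ⧺ z) ↾_) (sym (ℕ.+-identityʳ (length s)))) (trans (⧺-↾ s z 0) (++-identityʳ s))

-- If a cover had smaller sum than W s then, halving repeatedly, there would be
-- a branch x along which the cover stays smaller than W.
module _ (em : ExcludedMiddle 0ℓ) {B : Pred Cantor 0ℓ} {W : List Bool → ℚ}
  (W-split : ∀ t → W t ≤ W (t ∷ʳ false) + W (t ∷ʳ true))
  (W≤μN : ∀ t → W t ≤ μN t)
  (W≤0 : ∀ {x} → ¬ B x → ∀ m → ∃[ n ] m ℕ.≤ n × W (x ↾ n) ≤ 0ℚ)
  where

  μ-lower : ∀ s → ¬ (μ (B ∩ N s) <ʳ W s)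
  μ-lower s (c , B∩Ns⊆c , p , p<Ws , sums≤p) = end (branch next s
      (p , p<Ws , λ k → ≤-trans (∑-mono (ν≤μN s) c k) (sums≤p k)))
    where
    covered : List Bool → ℕ → ℚ
    covered t = ∑ (λ u → ν u t) c

    Small : List Bool → Set
    Small t = ∃[ p ] p < W t × (∀ k → covered t k ≤ p)

    next : ∀ t → Small t → ∃[ b ] Small (t ∷ʳ b)
    next t (p , p<Wt , cov≤p) with em {∃[ k ] W t₀ - ½ * gap < covered t₀ k} | em {∃[ k ] W t₁ - ½ * gap < covered t₁ k}
      where
      t₀ t₁ : List Bool
      t₀ = t ∷ʳ false
      t₁ = t ∷ʳ true
      -- Each child is granted half of the slack. If the covered mass came closer than that to `W`
      -- at both children, the two together would exceed `p`.
      gap : ℚ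
      gap = W t₀ + W t₁ - p
    ... | no ¬k | _ = false , _ , small , λ k → ≮⇒≥ (λ lt → ¬k (k , lt))
      where
      small : W (t ∷ʳ false) - ½ * (W (t ∷ʳ false) + W (t ∷ʳ true) - p) < W (t ∷ʳ false)
      small = p-q<p (W (t ∷ʳ false)) (½-positive (0<q-p (<-≤-trans p<Wt (W-split t))))
    ... | _ | no ¬k = true , _ , small , λ k → ≮⇒≥ (λ lt → ¬k (k , lt))
      where
      small : W (t ∷ʳ true) - ½ * (W (t ∷ʳ false) + W (t ∷ʳ true) - p) < W (t ∷ʳ true)
      small = p-q<p (W (t ∷ʳ true)) (½-positive (0<q-p (<-≤-trans p<Wt (W-split t))))
    ... | yes (k₀ , lt₀) | yes (k₁ , lt₁) = contradiction (cov≤p k) (<⇒≱ (begin-strict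
      p
        ≡⟨ solve 3 (λ p w v → p := (w :- con ½ :* (w :+ v :- p)) :+ (v :- con ½ :* (w :+ v :- p))) refl p (W t₀) (W t₁) ⟩
      (W t₀ - ½ * (W t₀ + W t₁ - p)) + (W t₁ - ½ * (W t₀ + W t₁ - p))
        <⟨ +-mono-< lt₀ lt₁ ⟩
      covered t₀ k₀ + covered t₁ k₁
        ≤⟨ +-mono-≤ (∑-monoʳ (ν-nonneg t₀) c (ℕ.m≤m⊔n k₀ k₁)) (∑-monoʳ (ν-nonneg t₁) c (ℕ.m≤n⊔m k₀ k₁)) ⟩
      covered t₀ k + covered t₁ k
        ≡⟨ ∑-+ (ν-split t) c k ⟨
      covered t k
        ∎))
      where
      open ≤-Reasoning
      t₀ t₁ : List Bool
      t₀ = t ∷ʳ false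
      t₁ = t ∷ʳ true
      k : ℕ
      k = k₀ ℕ.⊔ k₁

    end : ¬ (∃[ x ] N s x × (∀ n → Small (x ↾ (length s ℕ.+ n))))
    end (x , x∈Ns , small) with em {B x}
    -- Some `c i` contains `x`; at a prefix `t` at least as long as `c i` that single set covers all
    -- of `N t`, so the covered mass is at least `μN t`.
    ... | yes Bx = <-irrefl refl (begin-strict
      covered t (suc i)  ≤⟨ proj₂ (proj₂ (small l)) (suc i) ⟩
      proj₁ (small l)    <⟨ proj₁ (proj₂ (small l)) ⟩
      W t                ≤⟨ W≤μN t ⟩
      μN t               ≡⟨ ν-↾ x (ℕ.m≤n+m l (length s)) ⟨
      ν (x ↾ l) t        ≡⟨ cong (λ u → ν u t) x∈ci ⟩
      ν (c i) t          ≤⟨ term≤∑ (ν-nonneg t) c i ⟩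
      covered t (suc i)  ∎)
      where
      open ≤-Reasoning
      i : ℕ
      i = proj₁ (B∩Ns⊆c (Bx , x∈Ns))
      x∈ci : N (c i) x
      x∈ci = proj₂ (B∩Ns⊆c (Bx , x∈Ns))
      l : ℕ
      l = length (c i)
      t : List Bool
      t = x ↾ (length s ℕ.+ l)
    -- Here some prefix beyond `s` has weight at most 0, whereas the empty partial sum gives
    -- `0 ≤ p < W`.
    ... | no ¬Bx with W≤0 ¬Bx (length s)
    ... | n , s≤n , Wn≤0 with small (n ℕ.∸ length s)
    ... | p , p<W , cov≤p rewrite ℕ.m+[n∸m]≡n s≤n = <⇒≱ p<W (≤-trans Wn≤0 (cov≤p 0))

-- Prefixes with the latest bit first, and auxiliary facts.

-- The prefix of length n with its most recent bit first.
_⇂_ : Cantor → ℕ → List Bool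
x ⇂ n = applyDownFrom x n

Nʳ : List Bool → Pred Cantor 0ℓ
Nʳ t z = z ⇂ length t ≡ t

Nʳ-⇂ : ∀ x n → Nʳ (x ⇂ n) x
Nʳ-⇂ x n = cong (x ⇂_) (length-applyDownFrom x n)

Nʳ-tail : ∀ {b t z} → Nʳ (b ∷ t) z → Nʳ t z
Nʳ-tail = ∷-injectiveʳ

⇂⇒↾ : ∀ {x z} n → z ⇂ n ≡ x ⇂ n → z ↾ n ≡ x ↾ n
⇂⇒↾ {x} {z} n eq = trans (sym (reverse-applyDownFrom z n)) (trans (cong reverse eq) (reverse-applyDownFrom x n))

Nʳ⇒N : ∀ {x z} n → Nʳ (x ⇂ n) z → N (x ↾ n) z
Nʳ⇒N {x} {z} n z∈ = trans (cong (z ↾_) (length-applyUpTo x n))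
  (⇂⇒↾ n (trans (cong (z ⇂_) (sym (length-applyDownFrom x n))) z∈))

N⇒↾ : ∀ {x z} n → N (x ↾ n) z → z ↾ n ≡ x ↾ n
N⇒↾ {x} {z} n z∈ = trans (cong (z ↾_) (sym (length-applyUpTo x n))) z∈

-- The fuel `d` bounds how far `f` can still rise above `f k`; each strict increase uses up at least
-- one unit.
stabilises : ExcludedMiddle 0ℓ → ∀ (f : ℕ → ℕ) M → (∀ {k l} → k ℕ.≤ l → f k ℕ.≤ f l) → (∀ k → f k ℕ.≤ M) →
             ∃[ k ] (∀ l → k ℕ.≤ l → f l ≡ f k)
stabilises em f M f-mono f≤M = go M 0 (ℕ.m≤n+m M (f 0))
  where
  go : ∀ d k → M ℕ.≤ f k ℕ.+ d → ∃[ k ] (∀ l → k ℕ.≤ l → f l ≡ f k)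
  go d k M≤ with em {∃[ l ] f k ℕ.< f l}
  ... | no  f≯ = k , λ l k≤l → ℕ.≤-antisym (ℕ.≮⇒≥ (λ lt → f≯ (l , lt))) (f-mono k≤l)
  go zero    k M≤ | yes (l , fk<fl) = contradiction
    (ℕ.≤-trans (f≤M l) (ℕ.≤-trans M≤ (ℕ.≤-reflexive (ℕ.+-identityʳ (f k))))) (ℕ.<⇒≱ fk<fl)
  go (suc d) k M≤ | yes (l , fk<fl) = go d l
    (ℕ.≤-trans M≤ (ℕ.≤-trans (ℕ.≤-reflexive (ℕ.+-suc (f k) d)) (ℕ.+-monoˡ-≤ d fk<fl)))

bump : ℕ → (ℕ → ℕ) → ℕ → ℕ
bump ℓ c n = if does (n ℕ.≟ ℓ) then suc (c n) else c n

bump-≡ : ∀ ℓ c → bump ℓ c ℓ ≡ suc (c ℓ)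
bump-≡ ℓ c rewrite dec-true (ℓ ℕ.≟ ℓ) refl = refl

bump-≢ : ∀ {ℓ n} c → n ≢ ℓ → bump ℓ c n ≡ c n
bump-≢ {ℓ} {n} c n≢ℓ rewrite dec-false (n ℕ.≟ ℓ) n≢ℓ = refl

bump-≥ : ∀ ℓ c n → c n ℕ.≤ bump ℓ c n
bump-≥ ℓ c n with does (n ℕ.≟ ℓ)
... | true  = ℕ.n≤1+n (c n)
... | false = ℕ.≤-refl

½p+½q≤r : ∀ {p q r} → p ≤ r → q ≤ r → ½ * p + ½ * q ≤ r
½p+½q≤r {r = r} p≤r q≤r = ≤-trans
  (+-mono-≤ (*-monoˡ-≤-nonNeg ½ p≤r) (*-monoˡ-≤-nonNeg ½ q≤r)) (≤-reflexive (½p+½p≡p r))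

-- A cover of `B′` also covers `B`, which transfers the lower bounds; the upper ones come from
-- `μ<1+ε`.
Φ-mono : ∀ {B B′} → B ⊆ B′ → Φ B ⊆ Φ B′
Φ-mono B⊆B′ x∈Φ ε 0<ε with x∈Φ ε 0<ε
... | k , near = k , λ n k≤n →
  let (p , <p , ¬μ<p) , _ = near n k≤n
  in (p , <p , λ (c , cover , sums) → ¬μ<p (c , (λ (Bz , z∈N) → cover (B⊆B′ Bz , z∈N)) , sums)) ,
     μ<1+ε _ _ 0<ε

-- The codes 0 0 y₀ 0 0 y₁ ... and local criteria for continuity.

block : ℕ → ℕ
block zero    = 0
block (suc k) = 3 ℕ.+ block k

n≤block : ∀ n → n ℕ.≤ block n
n≤block zero    = z≤n
n≤block (suc n) = s≤s (ℕ.≤-trans (n≤block n) (ℕ.m≤n+m (block n) 2))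

position : ∀ {k n} → block k ℕ.≤ n → ∃[ l ] k ℕ.≤ l × (n ≡ block l ⊎ n ≡ 1 ℕ.+ block l ⊎ n ≡ 2 ℕ.+ block l)
position {k} = go ∘ ℕ.≤⇒≤′
  where
  go : ∀ {n} → block k ℕ.≤′ n → ∃[ l ] k ℕ.≤ l × (n ≡ block l ⊎ n ≡ 1 ℕ.+ block l ⊎ n ≡ 2 ℕ.+ block l)
  go (ℕ.≤′-reflexive refl) = k , ℕ.≤-refl , inj₁ refl
  go (ℕ.≤′-step k≤n) with go k≤n
  ... | l , k≤l , inj₁ refl        = l , k≤l , inj₂ (inj₁ refl)
  ... | l , k≤l , inj₂ (inj₁ refl) = l , k≤l , inj₂ (inj₂ refl)
  ... | l , k≤l , inj₂ (inj₂ refl) = suc l , ℕ.≤-trans k≤l (ℕ.n≤1+n l) , inj₁ refl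

encode decode : Cantor → Cantor
encode y 0                   = false
encode y 1                   = false
encode y 2                   = y 0
encode y (suc (suc (suc n))) = encode (y ∘ suc) n
decode x k = x (2 ℕ.+ block k)

Coded : Pred Cantor 0ℓ
Coded x = ∀ k → x (block k) ≡ false × x (1 ℕ.+ block k) ≡ false

↾-cong : ∀ {x z} n → (∀ i → i ℕ.< n → z i ≡ x i) → z ↾ n ≡ x ↾ n
↾-cong zero    eq = refl
↾-cong (suc n) eq = cong₂ _∷_ (eq 0 (s≤s z≤n)) (↾-cong n (λ i i<n → eq (suc i) (s≤s i<n)))

↾-injective : ∀ {x z} n → z ↾ n ≡ x ↾ n → ∀ i → i ℕ.< n → z i ≡ x i
↾-injective (suc n) eq zero    _         = ∷-injectiveˡ eq
↾-injective (suc n) eq (suc i) (s≤s i<n) = ↾-injective n (∷-injectiveʳ eq) i i<n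

↾⇒N : ∀ {x z} n → z ↾ n ≡ x ↾ n → N (x ↾ n) z
↾⇒N {x} {z} n eq = trans (cong (z ↾_) (length-applyUpTo x n)) eq

locally-determined⇒continuous : ∀ {f : Cantor → Cantor} →
  (∀ x m → ∃[ n ] (∀ z → z ↾ n ≡ x ↾ n → f z ↾ m ≡ f x ↾ m)) → Continuous f
locally-determined⇒continuous {f} local V-open {x} Vfx with V-open Vfx
... | m , Nm⊆V with local x m
... | n , agree = n , λ {z} z∈N → Nm⊆V (↾⇒N {f x} {f z} m (agree z (N⇒↾ {x} {z} n z∈N)))

encode-local : ∀ {y z} i → (∀ j → j ℕ.≤ i → z j ≡ y j) → encode z i ≡ encode y i
encode-local 0 eq = refl
encode-local 1 eq = refl
encode-local 2 eq = eq 0 z≤n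
encode-local (suc (suc (suc i))) eq =
  encode-local i (λ j j≤i → eq (suc j) (s≤s (ℕ.≤-trans j≤i (ℕ.m≤n+m i 2))))

encode-continuous : Continuous encode
encode-continuous = locally-determined⇒continuous λ y m → m , λ z eq →
  ↾-cong m (λ i i<m → encode-local i (λ j j≤i → ↾-injective m eq j (ℕ.≤-<-trans j≤i i<m)))

encode-coded : ∀ y → Coded (encode y)
encode-coded y zero    = refl , refl
encode-coded y (suc k) = encode-coded (y ∘ suc) k

decode-encode : ∀ y k → decode (encode y) k ≡ y k
decode-encode y zero    = refl
decode-encode y (suc k) = decode-encode (y ∘ suc) k

-- Extension of reversed prefixes.

data _≽_ : List Bool → List Bool → Set where
  ≽-refl : ∀ {t} → t ≽ t
  ≽-∷    : ∀ {t s b} → t ≽ s → (b ∷ t) ≽ s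

≽-trans : ∀ {t s r} → t ≽ s → s ≽ r → t ≽ r
≽-trans ≽-refl     s≽r = s≽r
≽-trans (≽-∷ t≽s) s≽r = ≽-∷ (≽-trans t≽s s≽r)

≽-[] : ∀ t → t ≽ []
≽-[] []      = ≽-refl
≽-[] (_ ∷ t) = ≽-∷ (≽-[] t)

⇂-≽ : ∀ x {m n} → m ℕ.≤ n → (x ⇂ n) ≽ (x ⇂ m)
⇂-≽ x {m} m≤n = go (ℕ.≤⇒≤′ m≤n)
  where
  go : ∀ {n} → m ℕ.≤′ n → (x ⇂ n) ≽ (x ⇂ m)
  go (ℕ.≤′-reflexive refl) = ≽-refl
  go (ℕ.≤′-step m≤n)       = ≽-∷ (go m≤n)

Nʳ-≽ : ∀ {t s z} → t ≽ s → Nʳ t z → Nʳ s z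
Nʳ-≽ ≽-refl z∈t = z∈t
Nʳ-≽ {z = z} (≽-∷ {t} {s} {b} t≽s) z∈t = Nʳ-≽ t≽s (Nʳ-tail {b} {t} {z} z∈t)

Nʳ-nonempty : ∀ t → ∃[ z ] Nʳ t z
Nʳ-nonempty t = z , (begin
  z ⇂ length t                 ≡⟨ reverse-applyUpTo z (length t) ⟨
  reverse (z ↾ length t)       ≡⟨ cong (λ n → reverse (z ↾ n))
                                    (trans (sym (length-reverse t)) (sym (ℕ.+-identityʳ _))) ⟩
  reverse (z ↾ (length (reverse t) ℕ.+ 0))  ≡⟨ cong reverse (trans (⧺-↾ (reverse t) _ 0) (++-identityʳ (reverse t))) ⟩
  reverse (reverse t)          ≡⟨ reverse-involutive t ⟩
  t                            ∎)
  where
  open ≡-Reasoning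
  z : Cantor
  z = reverse t ⧺ λ _ → false

-- Guesses and levels: `A` as the set where the level tends to infinity.

module Construction (em : ExcludedMiddle 0ℓ) (A : Pred Cantor 0ℓ) (K : ℕ → ℕ → Pred Cantor 0ℓ)
  (K-closed : ∀ n m → IsClosed (K n m))
  (A⇒K : ∀ {y} → A y → ∀ n → ∃[ m ] K n m y)
  (K⇒A : ∀ {y} → (∀ n → ∃[ m ] K n m y) → A y)
  where

  -- Because `A z` is demanded as well, every guess is refuted once `t` has no extension in `A`.
  -- This drives the level to 0 there, on which the continuity of `retract` rests.
  Refuted : ℕ → ℕ → List Bool → Set
  Refuted n m t = ¬ (∃[ z ] Nʳ t z × A z × K n m z)

  refuted-∷ : ∀ {n m b t} → Refuted n m t → Refuted n m (b ∷ t)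
  refuted-∷ r (z , z∈t , rest) = r (z , Nʳ-tail {z = z} z∈t , rest)

  refuted-mono : ∀ y {n m k l} → k ℕ.≤ l → Refuted n m (y ⇂ k) → Refuted n m (y ⇂ l)
  refuted-mono y {n} {m} {k} k≤l r = go (ℕ.≤⇒≤′ k≤l)
    where
    go : ∀ {l} → k ℕ.≤′ l → Refuted n m (y ⇂ l)
    go (ℕ.≤′-reflexive refl) = r
    go (ℕ.≤′-step k≤l)       = refuted-∷ (go k≤l)

  -- At level ℓ with guesses c, the point is believed to lie in A and in
  -- K n (c n) for each n < ℓ.  A refuted guess lowers the level by one at a
  -- time, so a guess is only revised when the level has come down to its index.
  data Move (t : List Bool) (ℓ : ℕ) (c : ℕ → ℕ) (ℓ′ : ℕ) (c′ : ℕ → ℕ) : Set where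
    down : ∀ {n} → n ℕ.< ℓ → Refuted n (c n) t → ℓ′ ≡ pred ℓ → c′ ≡ c → Move t ℓ c ℓ′ c′
    stay : (∀ {n} → n ℕ.< ℓ → ¬ Refuted n (c n) t) → Refuted ℓ (c ℓ) t →
           ℓ′ ≡ ℓ → c′ ≡ bump ℓ c → Move t ℓ c ℓ′ c′
    up   : (∀ {n} → n ℕ.≤ ℓ → ¬ Refuted n (c n) t) → ℓ′ ≡ suc ℓ → c′ ≡ c → Move t ℓ c ℓ′ c′

  move : ∀ t ℓ c → ∃[ ℓ′ ] ∃[ c′ ] Move t ℓ c ℓ′ c′
  move t ℓ c with em {∃[ n ] n ℕ.< ℓ × Refuted n (c n) t}
  ... | yes (n , n<ℓ , r) = -, -, down n<ℓ r refl refl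
  ... | no ¬r with em {Refuted ℓ (c ℓ) t}
  ...   | yes r  = -, -, stay (λ n<ℓ r → ¬r (_ , n<ℓ , r)) r refl refl
  ...   | no ¬rℓ = -, -, up guesses refl refl
    where
    guesses : ∀ {n} → n ℕ.≤ ℓ → ¬ Refuted n (c n) t
    guesses n≤ℓ r with ℕ.m≤n⇒m<n∨m≡n n≤ℓ
    ... | inj₁ n<ℓ  = ¬r (_ , n<ℓ , r)
    ... | inj₂ refl = ¬rℓ r

  level : List Bool → ℕ
  guess : List Bool → ℕ → ℕ
  level []      = 0
  level (_ ∷ t) = proj₁ (move t (level t) (guess t))
  guess []      = λ _ → 0
  guess (_ ∷ t) = proj₁ (proj₂ (move t (level t) (guess t)))

  level-move : ∀ b t → Move t (level t) (guess t) (level (b ∷ t)) (guess (b ∷ t))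
  level-move b t = proj₂ (proj₂ (move t (level t) (guess t)))

  level-∷ : ∀ b t → pred (level t) ℕ.≤ level (b ∷ t)
  level-∷ b t with level-move b t
  ... | down _ _ eq _ = ℕ.≤-reflexive (sym eq)
  ... | stay _ _ eq _ = ℕ.≤-trans ℕ.pred[n]≤n (ℕ.≤-reflexive (sym eq))
  ... | up _ eq _     = ℕ.≤-trans ℕ.pred[n]≤n (ℕ.≤-trans (ℕ.n≤1+n _) (ℕ.≤-reflexive (sym eq)))

  Meets : List Bool → Set
  Meets t = ∃[ z ] Nʳ t z × A z

  level-∷≡0 : ∀ {b t} → ¬ Meets t → level t ≡ 0 → level (b ∷ t) ≡ 0
  level-∷≡0 {b} {t} ¬meets ℓ≡0 with level-move b t
  ... | down n<ℓ _ _ _ = contradiction (subst (_ ℕ.<_) ℓ≡0 n<ℓ) ℕ.n≮0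
  ... | stay _ _ eq _  = trans eq ℓ≡0
  ... | up ¬r _ _      = contradiction (λ (z , z∈t , Az , _) → ¬meets (z , z∈t , Az)) (¬r z≤n)

  guess-suc : ∀ b t n → guess t n ℕ.≤ guess (b ∷ t) n
  guess-suc b t n with level-move b t
  ... | down _ _ _ eq = ℕ.≤-reflexive (sym (cong (λ c → c n) eq))
  ... | stay _ _ _ eq = ℕ.≤-trans (bump-≥ (level t) (guess t) n) (ℕ.≤-reflexive (sym (cong (λ c → c n) eq)))
  ... | up _ _ eq     = ℕ.≤-reflexive (sym (cong (λ c → c n) eq))

  guess-mono : ∀ y n {k l} → k ℕ.≤ l → guess (y ⇂ k) n ℕ.≤ guess (y ⇂ l) n
  guess-mono y n {k} k≤l = go (ℕ.≤⇒≤′ k≤l)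
    where
    go : ∀ {l} → k ℕ.≤′ l → guess (y ⇂ k) n ℕ.≤ guess (y ⇂ l) n
    go (ℕ.≤′-reflexive refl)          = ℕ.≤-refl
    go {suc l} (ℕ.≤′-step k≤l) = ℕ.≤-trans (go k≤l) (guess-suc (y l) (y ⇂ l) n)

  -- As long as the level exceeds `n`, the standing refutation excludes `stay` and `up`, and `down`
  -- leaves all guesses alone. So the level descends step by step to exactly `n`.
  drop : ∀ y {n k} → n ℕ.< level (y ⇂ k) → Refuted n (guess (y ⇂ k) n) (y ⇂ k) →
         ∃[ j ] k ℕ.≤ j × level (y ⇂ j) ≡ n × guess (y ⇂ j) n ≡ guess (y ⇂ k) n
  drop y {n} {k} n<ℓ = go (level (y ⇂ k) ℕ.∸ suc n) k (sym (trans (sym (ℕ.+-suc _ n)) (ℕ.m∸n+n≡m n<ℓ)))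
    where
    go : ∀ d k → level (y ⇂ k) ≡ suc (d ℕ.+ n) → Refuted n (guess (y ⇂ k) n) (y ⇂ k) →
         ∃[ j ] k ℕ.≤ j × level (y ⇂ j) ≡ n × guess (y ⇂ j) n ≡ guess (y ⇂ k) n
    go d k ℓ≡ r with level-move (y k) (y ⇂ k)
    ... | stay ¬r _ _ _ = contradiction r (¬r (subst (n ℕ.<_) (sym ℓ≡) (s≤s (ℕ.m≤n+m n d))))
    ... | up   ¬r _ _   = contradiction r (¬r (subst (n ℕ.≤_) (sym ℓ≡) (ℕ.m≤n+m n (suc d))))
    go zero k ℓ≡ r | down _ _ ℓ′≡ c′≡ = suc k , ℕ.n≤1+n k , trans ℓ′≡ (cong pred ℓ≡) , cong (λ c → c n) c′≡
    go (suc d) k ℓ≡ r | down _ _ ℓ′≡ c′≡ =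
      let j , k<j , ℓⱼ≡n , cⱼ≡ = go d (suc k) (trans ℓ′≡ (cong pred ℓ≡))
            (subst (λ m → Refuted n m (y ⇂ suc k)) (sym (cong (λ c → c n) c′≡)) (refuted-∷ r))
      in j , ℕ.<⇒≤ k<j , ℓⱼ≡n , trans cⱼ≡ (cong (λ c → c n) c′≡)

  -- The point `y` itself prevents `m` from being refuted, so a guess that has reached `m` is never
  -- bumped.
  guess-bounded : ∀ {y n m} → A y → K n m y → ∀ k → guess (y ⇂ k) n ℕ.≤ m
  guess-bounded Ay Ky zero = z≤n
  guess-bounded {y} {n} {m} Ay Ky (suc k) with level-move (y k) (y ⇂ k)
  ... | down _ _ _ eq = subst (ℕ._≤ m) (sym (cong (λ c → c n) eq)) (guess-bounded Ay Ky k)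
  ... | up _ _ eq     = subst (ℕ._≤ m) (sym (cong (λ c → c n) eq)) (guess-bounded Ay Ky k)
  ... | stay _ r _ eq with n ℕ.≟ level (y ⇂ k)
  ...   | no n≢ℓ   = subst (ℕ._≤ m) (sym (trans (cong (λ c → c n) eq) (bump-≢ (guess (y ⇂ k)) n≢ℓ))) (guess-bounded Ay Ky k)
  ...   | yes refl = subst (ℕ._≤ m) (sym (trans (cong (λ c → c n) eq) (bump-≡ n (guess (y ⇂ k)))))
    (ℕ.≤∧≢⇒< (guess-bounded Ay Ky k)
      (λ g≡m → r (y , Nʳ-⇂ y k , Ay , subst (λ m → K n m y) (sym g≡m) Ky)))

  Ascends : Cantor → Set
  Ascends y = ∀ L → ∃[ k ] (∀ l → k ℕ.≤ l → L ℕ.≤ level (y ⇂ l))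

  -- Induction on `L`: wait until the level stays at least `L` and the guess for `L` is final. A
  -- refuted guess for `L` at level `L` would then either be bumped or push the level below `L`;
  -- both are excluded, so the level rises past `L` for good.
  ascends : ∀ {y} → A y → Ascends y
  ascends {y} Ay zero    = 0 , λ _ _ → z≤n
  ascends {y} Ay (suc L) = suc k₀ , λ where (suc l) (s≤s k₀≤l) → higher l k₀≤l
    where
    k₁ : ℕ
    k₁ = proj₁ (ascends Ay L)
    stable : ∃[ k ] (∀ l → k ℕ.≤ l → guess (y ⇂ l) L ≡ guess (y ⇂ k) L)
    stable = stabilises em (λ k → guess (y ⇂ k) L) _ (guess-mono y L) (guess-bounded Ay (proj₂ (A⇒K Ay L)))
    k₂ : ℕ
    k₂ = proj₁ stable
    k₀ : ℕ
    k₀ = k₁ ℕ.⊔ k₂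

    L≤level : ∀ l → k₀ ℕ.≤ l → L ℕ.≤ level (y ⇂ l)
    L≤level l k₀≤l = proj₂ (ascends Ay L) l (ℕ.≤-trans (ℕ.m≤m⊔n k₁ k₂) k₀≤l)

    no-bump : ∀ l → k₀ ℕ.≤ l → guess (y ⇂ suc l) L ≢ suc (guess (y ⇂ l) L)
    no-bump l k₀≤l eq = ℕ.1+n≢n (trans (sym eq)
      (trans (proj₂ stable (suc l) (ℕ.≤-trans k₂≤l (ℕ.n≤1+n l))) (sym (proj₂ stable l k₂≤l))))
      where
      k₂≤l : k₂ ℕ.≤ l
      k₂≤l = ℕ.≤-trans (ℕ.m≤n⊔m k₁ k₂) k₀≤l

    not-refuted-at : ∀ j → k₀ ℕ.≤ j → level (y ⇂ j) ≡ L → ¬ Refuted L (guess (y ⇂ j) L) (y ⇂ j)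
    not-refuted-at j k₀≤j ℓ≡L r with level-move (y j) (y ⇂ j)
    ... | down n<ℓ _ eq _ = ℕ.<⇒≱
      (ℕ.≤-reflexive (trans (cong suc eq) (ℕ.suc-pred _ {{ℕ.>-nonZero (ℕ.≤-<-trans z≤n n<ℓ)}})))
      (subst (ℕ._≤ level (y ⇂ suc j)) (sym ℓ≡L) (L≤level (suc j) (ℕ.≤-trans k₀≤j (ℕ.n≤1+n j))))
    ... | stay _ _ _ eq = no-bump j k₀≤j (trans (cong (λ c → c L) eq)
                            (trans (cong (λ ℓ → bump ℓ (guess (y ⇂ j)) L) ℓ≡L) (bump-≡ L (guess (y ⇂ j)))))
    ... | up ¬r _ _ = ¬r (ℕ.≤-reflexive (sym ℓ≡L)) r

    not-refuted : ∀ l → k₀ ℕ.≤ l → ∀ {n} → n ℕ.≤ L → n ℕ.< level (y ⇂ l) → ¬ Refuted n (guess (y ⇂ l) n) (y ⇂ l)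
    not-refuted l k₀≤l n≤L n<ℓ r with drop y n<ℓ r
    -- The drop ends at level `n`, which is at least `L` this late; so `n` is `L`, and the
    -- refutation persists at level `L`.
    ... | j , l≤j , refl , g≡ with ℕ.≤-antisym n≤L (L≤level j (ℕ.≤-trans k₀≤l l≤j))
    ... | refl = not-refuted-at j (ℕ.≤-trans k₀≤l l≤j) refl
      (subst (λ m → Refuted _ m (y ⇂ j)) (sym g≡) (refuted-mono y l≤j r))

    higher : ∀ l → k₀ ℕ.≤ l → suc L ℕ.≤ level (y ⇂ suc l)
    higher l k₀≤l with level-move (y l) (y ⇂ l)
    -- The refuted index exceeds `L`, so the level was at least `L + 2` before falling.
    ... | down n<ℓ r eq _ = subst (suc L ℕ.≤_) (sym eq)
      (ℕ.≤-trans (ℕ.≰⇒> (λ n≤L → not-refuted l k₀≤l n≤L n<ℓ r)) (ℕ.<⇒≤pred n<ℓ))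
    ... | stay _ r eq _ = subst (suc L ℕ.≤_) (sym eq)
      (ℕ.≤∧≢⇒< (L≤level l k₀≤l) λ L≡ℓ → not-refuted-at l k₀≤l (sym L≡ℓ)
        (subst (λ ℓ → Refuted ℓ (guess (y ⇂ l) ℓ) (y ⇂ l)) (sym L≡ℓ) r))
    ... | up _ eq _ = subst (suc L ℕ.≤_) (sym eq) (s≤s (L≤level l k₀≤l))

  -- While the level exceeds `n` the guess for `n` is fixed, since only the guess indexed by the
  -- level is bumped. A refutation would let `drop` return the level to `n`. As no prefix refutes
  -- the guess, `y` lies in the closed set `K n m`.
  ascends⇒A : ∀ {y} → Ascends y → A y
  ascends⇒A {y} asc = K⇒A λ n → guess (y ⇂ proj₁ (asc (suc n))) n , in-K n
    where
    module _ (n : ℕ) where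
      k : ℕ
      k = proj₁ (asc (suc n))
      m : ℕ
      m = guess (y ⇂ k) n

      n<level : ∀ {l} → k ℕ.≤ l → n ℕ.< level (y ⇂ l)
      n<level = proj₂ (asc (suc n)) _

      constant : ∀ {l} → k ℕ.≤′ l → guess (y ⇂ l) n ≡ m
      constant (ℕ.≤′-reflexive refl) = refl
      constant {suc l} (ℕ.≤′-step k≤l) with level-move (y l) (y ⇂ l)
      ... | down _ _ _ eq = trans (cong (λ c → c n) eq) (constant k≤l)
      ... | up _ _ eq     = trans (cong (λ c → c n) eq) (constant k≤l)
      ... | stay _ _ _ eq = trans (cong (λ c → c n) eq)
        (trans (bump-≢ (guess (y ⇂ l)) (ℕ.<⇒≢ (n<level (ℕ.≤′⇒≤ k≤l)))) (constant k≤l))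

      not-refuted : ∀ l → ¬ Refuted n m (y ⇂ l)
      not-refuted l r with ℕ.m≤n⊔m l k
      ... | k≤j with drop y (n<level k≤j) (subst (λ m → Refuted n m (y ⇂ (l ℕ.⊔ k)))
                       (sym (constant (ℕ.≤⇒≤′ k≤j))) (refuted-mono y (ℕ.m≤m⊔n l k) r))
      ... | i , j≤i , ℓ≡n , _ = ℕ.<⇒≢ (n<level (ℕ.≤-trans k≤j j≤i)) (sym ℓ≡n)

      in-K : K n m y
      in-K = decidable-stable em λ y∉K →
        let l , Nl⊆∁K = K-closed n m y∉K
        in not-refuted l λ (z , z∈ , _ , Kz) → Nl⊆∁K (Nʳ⇒N l z∈) Kz

  -- The automaton that defines `U` and `C`.

  Inside : List Bool → Set
  Inside t = ∀ z → Nʳ t z → A z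

  -- The automaton follows codes 0 0 y₀ 0 0 y₁ …; t is the part of y read so
  -- far.  A point leaving the codes is sent to good or to bad.  In gap t j it
  -- is sent to bad if the next 1 + j bits are all 0.
  data State : Set where
    main main′ bit good bad : List Bool → State
    gap                     : List Bool → ℕ → State

  enter : List Bool → ℕ → State
  enter t zero    = bad t
  enter t (suc j) = gap t j

  -- At positive level this good cone offsets a possible fall of the level at the next bit. At level
  -- 0 the level cannot fall; making the cone bad there ensures that a good exit has positive level
  -- or `Inside t`.
  zero-bad : List Bool → ℕ → State
  zero-bad t zero    = bad t
  zero-bad t (suc _) = good t

  -- If all extensions of `t` lie in `A`, a bad exit would have no nearby point outside `A` to be
  -- sent to.
  unless-inside : List Bool → State → State
  unless-inside t q = if does (em {Inside t}) then good t else q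

  step : State → Bool → State
  step (main t)  false = main′ t
  step (main t)  true  = unless-inside t (enter t (level t))
  step (main′ t) false = bit t
  step (main′ t) true  = unless-inside t (zero-bad t (level t))
  step (bit t)   b     = main (b ∷ t)
  step (gap t j) false = enter t j
  step (gap t j) true  = good t
  step (good t)  _     = good t
  step (bad t)   _     = bad t

  run : List Bool → State
  run = foldl step (main [])

  run-suc : ∀ x n → run (x ↾ suc n) ≡ step (run (x ↾ n)) (x n)
  run-suc x n = trans (cong run (sym (applyUpTo-∷ʳ x n))) (foldl-∷ʳ step (main []) (x n) (x ↾ n))

  run-const : ∀ {q} → (∀ b → step q b ≡ q) → ∀ x {m n} → m ℕ.≤ n → run (x ↾ m) ≡ q → run (x ↾ n) ≡ q
  run-const {q} fixed x {m} m≤n eq = go (ℕ.≤⇒≤′ m≤n)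
    where
    go : ∀ {n} → m ℕ.≤′ n → run (x ↾ n) ≡ q
    go (ℕ.≤′-reflexive refl)   = eq
    go {suc n} (ℕ.≤′-step m≤n) = trans (run-suc x n) (trans (cong (λ q → step q (x n)) (go m≤n)) (fixed (x n)))

  U C : Pred Cantor 0ℓ
  U x = ∃[ n ] ∃[ t ] run (x ↾ n) ≡ good t
  C x = ¬ (∃[ n ] ∃[ t ] run (x ↾ n) ≡ bad t)

  U-open : IsOpen U
  U-open {x} (n , t , eq) = n , λ {z} z∈N → n , t , trans (cong run (N⇒↾ {x} {z} n z∈N)) eq

  C-closed : IsClosed C
  C-closed {x} ¬Cx with decidable-stable em ¬Cx
  ... | n , t , eq = n , λ {z} z∈N Cz → Cz (n , t , trans (cong run (N⇒↾ {x} {z} n z∈N)) eq)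

  Valid : State → Set
  Valid (good t)  = Inside t ⊎ 0 ℕ.< level t
  Valid (bad t)   = ¬ Inside t
  Valid (gap t _) = ¬ Inside t × 0 ℕ.< level t
  Valid _         = ⊤

  step-valid : ∀ q b → Valid q → Valid (step q b)
  step-valid (main t) false _ = tt
  step-valid (main t) true  _ with em {Inside t}
  ... | yes inside = inj₁ inside
  ... | no ¬inside with level t in eq
  ...   | zero  = ¬inside
  ...   | suc j = ¬inside , subst (0 ℕ.<_) (sym eq) (s≤s z≤n)
  step-valid (main′ t) false _ = tt
  step-valid (main′ t) true  _ with em {Inside t}
  ... | yes inside = inj₁ inside
  ... | no ¬inside with level t in eq
  ...   | zero  = ¬inside
  ...   | suc j = inj₂ (subst (0 ℕ.<_) (sym eq) (s≤s z≤n))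
  step-valid (bit t) _ _ = tt
  step-valid (gap t zero) false (¬inside , _)    = ¬inside
  step-valid (gap t (suc j)) false valid = valid
  step-valid (gap t j) true  (_ , 0<ℓ) = inj₂ 0<ℓ
  step-valid (good t) _ valid = valid
  step-valid (bad t)  _ valid = valid

  run-valid : ∀ x n → Valid (run (x ↾ n))
  run-valid x zero    = tt
  run-valid x (suc n) = subst Valid (sym (run-suc x n)) (step-valid (run (x ↾ n)) (x n) (run-valid x n))

  Decided : Cantor → Set
  Decided x = ∃[ n ] ∃[ t ] (run (x ↾ n) ≡ good t ⊎ run (x ↾ n) ≡ bad t)

  enter-decided : ∀ x t j n → run (x ↾ n) ≡ enter t j → Decided x
  enter-decided x t zero    n eq = n , t , inj₂ eq
  enter-decided x t (suc j) n eq with x n in xn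
  ... | true  = suc n , t , inj₁ (trans (run-suc x n) (cong₂ step eq xn))
  ... | false = enter-decided x t j (suc n) (trans (run-suc x n) (cong₂ step eq xn))

  main-decided : ∀ x t n → run (x ↾ n) ≡ main t → x n ≡ true → Decided x
  main-decided x t n eq xn with em {Inside t} | trans (run-suc x n) (cong₂ step eq xn)
  ... | yes _ | eq′ = suc n , t , inj₁ eq′
  ... | no _  | eq′ = enter-decided x t (level t) (suc n) eq′

  main′-decided : ∀ x t n → run (x ↾ n) ≡ main′ t → x n ≡ true → Decided x
  main′-decided x t n eq xn with em {Inside t} | level t | trans (run-suc x n) (cong₂ step eq xn)
  ... | yes _ | _     | eq′ = suc n , t , inj₁ eq′
  ... | no _  | zero  | eq′ = suc n , t , inj₂ eq′
  ... | no _  | suc _ | eq′ = suc n , t , inj₁ eq′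

  run-main′ : ∀ x t n → run (x ↾ n) ≡ main t → x n ≡ false → run (x ↾ suc n) ≡ main′ t
  run-main′ x t n eq xn = trans (run-suc x n) (cong₂ step eq xn)

  run-bit : ∀ x t n → run (x ↾ n) ≡ main t → x n ≡ false → x (suc n) ≡ false → run (x ↾ (2 ℕ.+ n)) ≡ bit t
  run-bit x t n eq xn xn′ = trans (run-suc x (suc n)) (cong₂ step (run-main′ x t n eq xn) xn′)

  run-next : ∀ x t n → run (x ↾ n) ≡ main t → x n ≡ false → x (suc n) ≡ false →
             run (x ↾ (3 ℕ.+ n)) ≡ main (x (2 ℕ.+ n) ∷ t)
  run-next x t n eq xn xn′ = trans (run-suc x (2 ℕ.+ n)) (cong (λ q → step q (x (2 ℕ.+ n))) (run-bit x t n eq xn xn′))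

  run-coded : ∀ x k → (∀ l → l ℕ.< k → x (block l) ≡ false × x (1 ℕ.+ block l) ≡ false) →
              run (x ↾ block k) ≡ main (decode x ⇂ k)
  run-coded x zero    _     = refl
  run-coded x (suc k) coded = run-next x (decode x ⇂ k) (block k)
    (run-coded x k (λ l l<k → coded l (ℕ.m≤n⇒m≤1+n l<k)))
    (proj₁ (coded k ℕ.≤-refl)) (proj₂ (coded k ℕ.≤-refl))

  -- A point departs from the codes at its first separator bit 1, and each exit gets decided: in
  -- `gap t j` a one is good, and a zero counts `j` down towards bad.
  ¬decided⇒coded : ∀ {x} → ¬ Decided x → Coded x
  ¬decided⇒coded {x} ¬dec k = go (suc k) k ℕ.≤-refl
    where
    go : ∀ k l → l ℕ.< k → x (block l) ≡ false × x (1 ℕ.+ block l) ≡ false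
    go (suc k) l (s≤s l≤k) with ℕ.m≤n⇒m<n∨m≡n l≤k
    ... | inj₁ l<k  = go k l l<k
    ... | inj₂ refl with x (block k) in eq | run-coded x k (go k)
    ...   | true  | at = contradiction (main-decided x _ _ at eq) ¬dec
    ...   | false | at with x (1 ℕ.+ block k) in eq′
    ...     | true  = contradiction (main′-decided x _ _ (run-main′ x _ _ at eq) eq′) ¬dec
    ...     | false = refl , refl

  coded⇒main : ∀ {x} → Coded x → ∀ k → run (x ↾ block k) ≡ main (decode x ⇂ k)
  coded⇒main {x} coded k = run-coded x k (λ l _ → coded l)

  -- Supermartingales that bound the measure of `U` from below.

  -- deficit (run s) bounds the proportion of N s outside U, up to the null set
  -- of codes; that is accounted for by any multiple of excess, which is
  -- unbounded along a code.

  deficit : State → ℚ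
  deficit (main t)  = ½^ level t
  deficit (main′ t) = ½^ level t
  deficit (bit t)   = ½^ pred (level t)
  deficit (gap t j) = ½^ suc j
  deficit (good _)  = 0ℚ
  deficit (bad _)   = 1ℚ

  excess : State → ℚ
  excess (main t)  = 2^ length t
  excess (main′ t) = 2^ suc (length t)
  excess (bit t)   = 2^ suc (length t)
  excess _         = 0ℚ

  deficit-nonneg : ∀ q → 0ℚ ≤ deficit q
  deficit-nonneg (main t)  = <⇒≤ (½^-positive (level t))
  deficit-nonneg (main′ t) = <⇒≤ (½^-positive (level t))
  deficit-nonneg (bit t)   = <⇒≤ (½^-positive (pred (level t)))
  deficit-nonneg (gap t j) = <⇒≤ (½^-positive (suc j))
  deficit-nonneg (good _)  = ≤-refl
  deficit-nonneg (bad _)   = nonNegative⁻¹ 1ℚ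

  excess-nonneg : ∀ q → 0ℚ ≤ excess q
  excess-nonneg (main t)  = <⇒≤ (2^-positive (length t))
  excess-nonneg (main′ t) = <⇒≤ (2^-positive (suc (length t)))
  excess-nonneg (bit t)   = <⇒≤ (2^-positive (suc (length t)))
  excess-nonneg (gap t j) = ≤-refl
  excess-nonneg (good _)  = ≤-refl
  excess-nonneg (bad _)   = ≤-refl

  deficit-enter : ∀ t j → deficit (enter t j) ≡ ½^ j
  deficit-enter t zero    = refl
  deficit-enter t (suc j) = refl

  ½p+½0 : ∀ p → ½ * p + ½ * 0ℚ ≡ ½ * p
  ½p+½0 p = +-identityʳ (½ * p)

  -- At `main` neither bit raises the deficit. At `main′` the good exit halves it when the level is
  -- positive, which pays for the `pred` at `bit`; there `level-∷` bounds the level after either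
  -- bit.
  deficit-super : ∀ q → ½ * deficit (step q false) + ½ * deficit (step q true) ≤ deficit q
  deficit-super (main t) = ½p+½q≤r ≤-refl exit
    where
    exit : deficit (step (main t) true) ≤ ½^ level t
    exit with em {Inside t}
    ... | yes _ = <⇒≤ (½^-positive (level t))
    ... | no  _ = ≤-reflexive (deficit-enter t (level t))
  deficit-super (main′ t) with em {Inside t} | level t
  ... | yes _ | zero  = ½p+½q≤r ≤-refl (nonNegative⁻¹ 1ℚ)
  ... | yes _ | suc j = ≤-reflexive (½p+½0 (½^ j))
  ... | no _  | zero  = ≤-refl
  ... | no _  | suc j = ≤-reflexive (½p+½0 (½^ j))
  deficit-super (bit t)   = ½p+½q≤r (½^-antitone (level-∷ false t)) (½^-antitone (level-∷ true t))
  deficit-super (gap t j) = ≤-reflexive (trans (½p+½0 (deficit (enter t j))) (cong (½ *_) (deficit-enter t j)))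
  deficit-super (good _)  = ≤-refl
  deficit-super (bad _)   = ≤-refl

  excess-enter : ∀ t j → excess (enter t j) ≡ 0ℚ
  excess-enter t zero    = refl
  excess-enter t (suc j) = refl

  -- The exit from `main` carries no excess, so the branch that follows the code may double it, once
  -- per block.
  excess-super : ∀ q → ½ * excess (step q false) + ½ * excess (step q true) ≤ excess q
  excess-super (main t) = ≤-reflexive (trans (cong (λ p → ½ * 2^ suc (length t) + ½ * p) exit)
    (solve 1 (λ p → con ½ :* (p :+ p) :+ con ½ :* con 0ℚ := p) refl (2^ length t)))
    where
    exit : excess (step (main t) true) ≡ 0ℚ
    exit with em {Inside t}
    ... | yes _ = refl
    ... | no  _ = excess-enter t (level t)
  excess-super (main′ t) = ½p+½q≤r ≤-refl exit
    where
    exit : excess (step (main′ t) true) ≤ 2^ suc (length t)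
    exit with em {Inside t} | level t
    ... | yes _ | _     = <⇒≤ (2^-positive (suc (length t)))
    ... | no _  | zero  = <⇒≤ (2^-positive (suc (length t)))
    ... | no _  | suc _ = <⇒≤ (2^-positive (suc (length t)))
  excess-super (bit t)   = ½p+½q≤r ≤-refl ≤-refl
  excess-super (gap t j) = ½p+½q≤r (≤-reflexive (excess-enter t j)) ≤-refl
  excess-super (good _)  = ≤-refl
  excess-super (bad _)   = ≤-refl

  excess-small : ∀ q {η} → 0ℚ < η → ∃[ δ ] 0ℚ < δ × δ * excess q ≤ η
  excess-small q {η} 0<η = go q
    where
    power : ∀ n → ∃[ δ ] 0ℚ < δ × δ * 2^ n ≤ η
    power n = η * ½^ n ,
      subst (_< η * ½^ n) (*-zeroʳ η) (*-monoʳ-<-pos η {{positive 0<η}} (½^-positive n)) ,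
      ≤-reflexive (trans (*-assoc η (½^ n) (2^ n)) (trans (cong (η *_) (½^*2^≡1 n)) (*-identityʳ η)))
    none : ∃[ δ ] 0ℚ < δ × δ * 0ℚ ≤ η
    none = η , 0<η , ≤-trans (≤-reflexive (*-zeroʳ η)) (<⇒≤ 0<η)
    go : ∀ q → ∃[ δ ] 0ℚ < δ × δ * excess q ≤ η
    go (main t)  = power (length t)
    go (main′ t) = power (suc (length t))
    go (bit t)   = power (suc (length t))
    go (gap _ _) = none
    go (good _)  = none
    go (bad _)   = none

  module _ {δ} (0<δ : 0ℚ < δ) where

    private
      potential : State → ℚ
      potential q = deficit q + δ * excess q

      weight : List Bool → ℚ
      weight s = (1ℚ - potential (run s)) * μN s

      δ*-mono : ∀ {p q} → p ≤ q → δ * p ≤ δ * q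
      δ*-mono = *-monoˡ-≤-nonNeg δ {{nonNegative (<⇒≤ 0<δ)}}

      δ*-nonneg : ∀ {p} → 0ℚ ≤ p → 0ℚ ≤ δ * p
      δ*-nonneg {p} 0≤p = subst (_≤ δ * p) (*-zeroʳ δ) (δ*-mono 0≤p)

      potential-nonneg : ∀ q → 0ℚ ≤ potential q
      potential-nonneg q = +-mono-≤ (deficit-nonneg q) (δ*-nonneg (excess-nonneg q))

      potential-super : ∀ q → ½ * potential (step q false) + ½ * potential (step q true) ≤ potential q
      potential-super q = begin
        ½ * (d₀ + δ * e₀) + ½ * (d₁ + δ * e₁)
          ≡⟨ solve 5 (λ d d′ e e′ δ → con ½ :* (d :+ δ :* e) :+ con ½ :* (d′ :+ δ :* e′)
               := (con ½ :* d :+ con ½ :* d′) :+ δ :* (con ½ :* e :+ con ½ :* e′)) refl d₀ d₁ e₀ e₁ δ ⟩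
        (½ * d₀ + ½ * d₁) + δ * (½ * e₀ + ½ * e₁)
          ≤⟨ +-mono-≤ (deficit-super q) (δ*-mono (excess-super q)) ⟩
        potential q
          ∎
        where
        open ≤-Reasoning
        d₀ d₁ e₀ e₁ : ℚ
        d₀ = deficit (step q false)
        d₁ = deficit (step q true)
        e₀ = excess (step q false)
        e₁ = excess (step q true)

      weight-∷ʳ : ∀ s b → weight (s ∷ʳ b) ≡ (1ℚ - potential (step (run s) b)) * (½ * μN s)
      weight-∷ʳ s b = cong₂ (λ q m → (1ℚ - potential q) * m) (foldl-∷ʳ step (main []) b s) (μN-∷ʳ s b)

      weight-split : ∀ s → weight s ≤ weight (s ∷ʳ false) + weight (s ∷ʳ true)
      weight-split s = begin
        (1ℚ - potential (run s)) * μN s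
          ≤⟨ *μN-mono-≤ s (+-monoʳ-≤ 1ℚ (neg-antimono-≤ (potential-super (run s)))) ⟩
        (1ℚ - (½ * p₀ + ½ * p₁)) * μN s
          ≡⟨ solve 3 (λ p p′ m → (con 1ℚ :- (con ½ :* p :+ con ½ :* p′)) :* m
               := (con 1ℚ :- p) :* (con ½ :* m) :+ (con 1ℚ :- p′) :* (con ½ :* m)) refl p₀ p₁ (μN s) ⟩
        (1ℚ - p₀) * (½ * μN s) + (1ℚ - p₁) * (½ * μN s)
          ≡⟨ cong₂ _+_ (weight-∷ʳ s false) (weight-∷ʳ s true) ⟨
        weight (s ∷ʳ false) + weight (s ∷ʳ true)
          ∎
        where
        open ≤-Reasoning
        p₀ p₁ : ℚ
        p₀ = potential (step (run s) false)
        p₁ = potential (step (run s) true)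

      weight≤μN : ∀ s → weight s ≤ μN s
      weight≤μN s = ≤-trans (*μN-mono-≤ s (p-q≤p 1ℚ (potential-nonneg (run s)))) (≤-reflexive (*-identityˡ (μN s)))

      weight≤0 : ∀ s → 1ℚ ≤ potential (run s) → weight s ≤ 0ℚ
      weight≤0 s 1≤p = ≤-trans (*μN-mono-≤ s (+-monoʳ-≤ 1ℚ (neg-antimono-≤ 1≤p))) (≤-reflexive (*-zeroˡ (μN s)))

      -- Outside `U` the point is either bad, with deficit 1 from then on, or a code; along a code
      -- the excess is `2^ l` after `l` blocks, so `δ` times it eventually reaches 1.
      weight-outside : ∀ {x} → ¬ U x → ∀ m → ∃[ n ] m ℕ.≤ n × weight (x ↾ n) ≤ 0ℚ
      weight-outside {x} ¬Ux m with em {Decided x}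
      ... | yes (n , t , inj₁ eq) = contradiction (n , t , eq) ¬Ux
      ... | yes (n , t , inj₂ eq) = n ℕ.⊔ m , ℕ.m≤n⊔m n m , weight≤0 (x ↾ (n ℕ.⊔ m))
        (subst (λ q → 1ℚ ≤ potential q) (sym (run-const (λ _ → refl) x (ℕ.m≤m⊔n n m) eq))
          (+-monoʳ-≤ 1ℚ (δ*-nonneg ≤-refl)))
      ... | no ¬dec with ½^-archimedean 0<δ
      ... | k , ½^k≤δ = block l , ℕ.≤-trans (ℕ.m≤n⊔m k m) (n≤block l) , weight≤0 (x ↾ block l)
        (subst (λ q → 1ℚ ≤ potential q) (sym (coded⇒main (¬decided⇒coded ¬dec) l)) (begin
          1ℚ                              ≡⟨ ½^*2^≡1 l ⟨
          ½^ l * 2^ l                     ≤⟨ *-monoʳ-≤-nonNeg (2^ l) {{nonNegative (<⇒≤ (2^-positive l))}}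
                                               (≤-trans (½^-antitone (ℕ.m≤m⊔n k m)) ½^k≤δ) ⟩
          δ * 2^ l                        ≡⟨ cong (λ n → δ * 2^ n) (length-applyDownFrom (decode x) l) ⟨
          δ * excess (main t)             ≡⟨ +-identityˡ _ ⟨
          0ℚ + δ * excess (main t)        ≤⟨ +-monoˡ-≤ _ (deficit-nonneg (main t)) ⟩
          potential (main t)              ∎))
        where
        open ≤-Reasoning
        l : ℕ
        l = k ℕ.⊔ m
        t : List Bool
        t = decode x ⇂ l

    U-measure : ∀ s → ¬ (μ (U ∩ N s) <ʳ (1ℚ - (deficit (run s) + δ * excess (run s))) * μN s)
    U-measure = μ-lower em weight-split weight≤μN weight-outside

  -- Densities of `U` and `C`.

  vanishing⇒ΦU : ∀ {x} → (∀ ε → 0ℚ < ε → ∃[ k ] (∀ n → k ℕ.≤ n → deficit (run (x ↾ n)) ≤ ε)) → Φ U x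
  -- A quarter of `ε` goes to the deficit and a quarter to the excess; the other half gives the
  -- strict inequality in `_ʳ<_`.
  vanishing⇒ΦU {x} vanishing ε 0<ε with vanishing (½ * (½ * ε)) (½-positive (½-positive 0<ε))
  ... | k , small = k , λ n k≤n → lower n k≤n , μ<1+ε U (x ↾ n) 0<ε
    where
    0<η : 0ℚ < ½ * (½ * ε)
    0<η = ½-positive (½-positive 0<ε)
    lower : ∀ n → k ℕ.≤ n → (1ℚ - ε) ʳ< (μ (U ∩ N (x ↾ n)) /ʳ μN (x ↾ n))
    lower n k≤n with excess-small (run (x ↾ n)) 0<η
    ... | δ , 0<δ , δe≤η = _ , +-monoʳ-< 1ℚ (neg-antimono-< (begin-strict
      deficit (run (x ↾ n)) + δ * excess (run (x ↾ n))  ≤⟨ +-mono-≤ (small n k≤n) δe≤η ⟩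
      ½ * (½ * ε) + ½ * (½ * ε)                         ≡⟨ ½p+½p≡p (½ * ε) ⟩
      ½ * ε                                             ≡⟨ +-identityʳ (½ * ε) ⟨
      ½ * ε + 0ℚ                                        <⟨ +-monoʳ-< (½ * ε) (½-positive 0<ε) ⟩
      ½ * ε + ½ * ε                                     ≡⟨ ½p+½p≡p ε ⟩
      ε                                                 ∎)) , U-measure 0<δ (x ↾ n)
      where open ≤-Reasoning

  -- Arbitrarily late cylinders around `x` have a bad hole of relative measure at least `½^ L`. The
  -- tolerance `½^ suc L` matches the exponent in `μ-upper`.
  porous⇒¬ΦC : ∀ {x} L → (∀ k → ∃[ n ] k ℕ.≤ n × ∃[ u ] length u ℕ.≤ L × ∃[ t ] run ((x ↾ n) ++ u) ≡ bad t) → ¬ Φ C x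
  porous⇒¬ΦC {x} L porous x∈ΦC with x∈ΦC (½^ suc L) (½^-positive (suc L))
  ... | k , near with porous k
  ... | n , k≤n , u , u≤L , t , eq with near n k≤n
  ... | (p , <p , ¬μ<p) , _ = ¬μ<p (μ-upper (x ↾ n) u avoids
      (≤-<-trans (+-monoʳ-≤ 1ℚ (neg-antimono-≤ (½^-antitone (s≤s u≤L)))) <p))
    where
    avoids : ∀ {z} → C z → ¬ N ((x ↾ n) ++ u) z
    avoids Cz z∈N = Cz (length ((x ↾ n) ++ u) , t , trans (cong run z∈N) eq)

  U⇒ΦU : U ⊆ Φ U
  U⇒ΦU {x} (n , t , eq) = vanishing⇒ΦU λ ε 0<ε → n , λ m n≤m →
    subst (λ q → deficit q ≤ ε) (sym (run-const (λ _ → refl) x n≤m eq)) (<⇒≤ 0<ε)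

  coded-A⇒ΦU : ∀ {x} → Coded x → A (decode x) → Φ U x
  coded-A⇒ΦU {x} coded Ay = vanishing⇒ΦU vanish
    where
    y : Cantor
    y = decode x
    vanish : ∀ ε → 0ℚ < ε → ∃[ k ] (∀ n → k ℕ.≤ n → deficit (run (x ↾ n)) ≤ ε)
    vanish ε 0<ε with ½^-archimedean 0<ε
    -- One level more than `M`, since the deficit at `bit` involves the predecessor of the level.
    ... | M , ½^M≤ε with ascends Ay (suc M)
    ... | k , high = block k , small
      where
      at-level : ∀ {l} → M ℕ.≤ l → ½^ l ≤ ε
      at-level M≤l = ≤-trans (½^-antitone M≤l) ½^M≤ε
      small : ∀ n → block k ℕ.≤ n → deficit (run (x ↾ n)) ≤ ε
      small n k≤n with position k≤n
      ... | l , k≤l , inj₁ refl = subst (λ q → deficit q ≤ ε) (sym (coded⇒main coded l))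
        (at-level (ℕ.<⇒≤ (high l k≤l)))
      ... | l , k≤l , inj₂ (inj₁ refl) = subst (λ q → deficit q ≤ ε)
        (sym (run-main′ x _ _ (coded⇒main coded l) (proj₁ (coded l))))
        (at-level (ℕ.<⇒≤ (high l k≤l)))
      ... | l , k≤l , inj₂ (inj₂ refl) = subst (λ q → deficit q ≤ ε)
        (sym (run-bit x _ _ (coded⇒main coded l) (proj₁ (coded l)) (proj₂ (coded l))))
        (at-level (ℕ.<⇒≤pred (high l k≤l)))

  bad⇒¬ΦC : ∀ {x n t} → run (x ↾ n) ≡ bad t → ¬ Φ C x
  bad⇒¬ΦC {x} {n} {t} eq = porous⇒¬ΦC 0 λ k → n ℕ.⊔ k , ℕ.m≤n⊔m n k , [] , z≤n , t ,
    trans (foldl-++ step (main []) (x ↾ (n ℕ.⊔ k)) []) (run-const (λ _ → refl) x (ℕ.m≤m⊔n n k) eq)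

  enter-zeros : ∀ t j → foldl step (enter t j) (replicate j false) ≡ bad t
  enter-zeros t zero    = refl
  enter-zeros t (suc j) = enter-zeros t j

  main-bad : ∀ {t} → ¬ Inside t → foldl step (main t) (true ∷ replicate (level t) false) ≡ bad t
  main-bad {t} ¬inside rewrite dec-false (em {Inside t}) ¬inside = enter-zeros t (level t)

  -- The level of `decode x` does not tend to infinity, so it is below some `L` infinitely often.
  -- Each time a one followed by `level t` zeros leads to a bad hole, as `decode x` itself refutes
  -- `Inside t`.
  coded-¬A⇒¬ΦC : ∀ {x} → Coded x → ¬ A (decode x) → ¬ Φ C x
  coded-¬A⇒¬ΦC {x} coded ¬Ay x∈ΦC = ¬Ay (ascends⇒A λ L → decidable-stable em λ low →
    porous⇒¬ΦC L (λ k → hole L (decidable-stable em λ high →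
      low (k , λ l k≤l → ℕ.≮⇒≥ λ lt → high (l , k≤l , lt)))) x∈ΦC)
    where
    y : Cantor
    y = decode x
    hole : ∀ L {k} → ∃[ l ] k ℕ.≤ l × level (y ⇂ l) ℕ.< L →
           ∃[ n ] k ℕ.≤ n × ∃[ u ] length u ℕ.≤ L × ∃[ t ] run ((x ↾ n) ++ u) ≡ bad t
    hole L (l , k≤l , ℓ<L) = block l , ℕ.≤-trans k≤l (n≤block l) , true ∷ replicate (level t) false ,
      subst (λ m → suc m ℕ.≤ L) (sym (length-replicate (level t))) ℓ<L , t , (begin
        run ((x ↾ block l) ++ u)       ≡⟨ foldl-++ step (main []) (x ↾ block l) u ⟩
        foldl step (run (x ↾ block l)) u  ≡⟨ cong (λ q → foldl step q u) (coded⇒main coded l) ⟩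
        foldl step (main t) u           ≡⟨ main-bad (λ inside → ¬Ay (inside y (Nʳ-⇂ y l))) ⟩
        bad t                           ∎)
      where
      open ≡-Reasoning
      t u : List Bool
      t = y ⇂ l
      u = true ∷ replicate (level t) false

  -- The common value of `Φ U` and `Φ C` without measure: it is contained in `Φ U`, hence in `Φ C`,
  -- which is contained in it.
  Target : Pred Cantor 0ℓ
  Target x = U x ⊎ Coded x × A (decode x)

  target⇒ΦU : Target ⊆ Φ U
  target⇒ΦU (inj₁ Ux)           = U⇒ΦU Ux
  target⇒ΦU (inj₂ (coded , Ay)) = coded-A⇒ΦU coded Ay

  ΦC⇒target : Φ C ⊆ Target
  ΦC⇒target {x} x∈ΦC with em {Decided x}
  ... | yes (n , t , inj₁ eq) = inj₁ (n , t , eq)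
  ... | yes (n , t , inj₂ eq) = contradiction x∈ΦC (bad⇒¬ΦC {n = n} eq)
  ... | no ¬dec with em {A (decode x)}
  ...   | yes Ay = inj₂ (¬decided⇒coded ¬dec , Ay)
  ...   | no ¬Ay = contradiction x∈ΦC (coded-¬A⇒¬ΦC (¬decided⇒coded ¬dec) ¬Ay)

  U⊆C : U ⊆ C
  U⊆C {x} (n , t , eq) (m , t′ , eq′) with trans (sym (run-const (λ _ → refl) x (ℕ.m≤m⊔n n m) eq))
                                             (run-const (λ _ → refl) x (ℕ.m≤n⊔m n m) eq′)
  ... | ()

  ΦU⊆ΦC : Φ U ⊆ Φ C
  ΦU⊆ΦC = Φ-mono U⊆C

  -- The reduction of `A` to `Φ C`.

  A-resp : ∀ {x z} → (∀ i → z i ≡ x i) → A z → A x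
  A-resp {x} {z} z≗x Az = K⇒A λ n →
    let m , Kz = A⇒K Az n
    in m , decidable-stable em λ ¬Kx →
      let k , Nk⊆∁K = K-closed n m ¬Kx
      in Nk⊆∁K (↾⇒N {x} {z} k (↾-cong k (λ i _ → z≗x i))) Kz

  A≤ΦC : A ≤W Φ C
  A≤ΦC = encode , encode-continuous ,
    -- `decode (encode y)` agrees with `y` only pointwise, hence the detour through `A-resp`.
    (λ {y} Ay → ΦU⊆ΦC (coded-A⇒ΦU (encode-coded y) (A-resp (λ i → sym (decode-encode y i)) Ay))) ,
    λ {y} ∈ΦC → decidable-stable em λ ¬Ay →
      coded-¬A⇒¬ΦC (encode-coded y) (λ Ad → ¬Ay (A-resp (decode-encode y) Ad)) ∈ΦC

  -- The reduction of `Φ C` to `A`.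

  tag : State → List Bool
  tag (main t)  = t
  tag (main′ t) = t
  tag (bit t)   = t
  tag (gap t _) = t
  tag (good t)  = t
  tag (bad t)   = t

  step-tag : ∀ q b → tag (step q b) ≽ tag q
  step-tag (main t)  false = ≽-refl
  step-tag (main t)  true with em {Inside t} | level t
  ... | yes _ | _     = ≽-refl
  ... | no _  | zero  = ≽-refl
  ... | no _  | suc _ = ≽-refl
  step-tag (main′ t) false = ≽-refl
  step-tag (main′ t) true with em {Inside t} | level t
  ... | yes _ | _     = ≽-refl
  ... | no _  | zero  = ≽-refl
  ... | no _  | suc _ = ≽-refl
  step-tag (bit t)   _ = ≽-∷ ≽-refl
  step-tag (gap t zero)    false = ≽-refl
  step-tag (gap t (suc _)) false = ≽-refl
  step-tag (gap t _) true  = ≽-refl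
  step-tag (good t)  _ = ≽-refl
  step-tag (bad t)   _ = ≽-refl

  run-tag : ∀ x {m n} → m ℕ.≤ n → tag (run (x ↾ n)) ≽ tag (run (x ↾ m))
  run-tag x {m} m≤n = go (ℕ.≤⇒≤′ m≤n)
    where
    go : ∀ {n} → m ℕ.≤′ n → tag (run (x ↾ n)) ≽ tag (run (x ↾ m))
    go (ℕ.≤′-reflexive refl) = ≽-refl
    go {suc n} (ℕ.≤′-step m≤n) = ≽-trans
      (subst (λ q → tag q ≽ tag (run (x ↾ n))) (sym (run-suc x n)) (step-tag (run (x ↾ n)) (x n))) (go m≤n)

  Absorbing : State → Set
  Absorbing q = ∀ b → step q b ≡ q

  absorbing-unique : ∀ x m n {p q} → Absorbing p → Absorbing q → run (x ↾ m) ≡ p → run (x ↾ n) ≡ q → p ≡ q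
  absorbing-unique x m n p-abs q-abs eqp eqq = trans
    (sym (run-const p-abs x (ℕ.m≤m⊔n m n) eqp)) (run-const q-abs x (ℕ.m≤n⊔m m n) eqq)

  absorbing-tag : ∀ x m n {q} → Absorbing q → run (x ↾ n) ≡ q → tag q ≽ tag (run (x ↾ m))
  absorbing-tag x m n q-abs eq = subst (λ q → tag q ≽ tag (run (x ↾ m)))
    (run-const q-abs x (ℕ.m≤m⊔n n m) eq) (run-tag x (ℕ.m≤n⊔m n m))

  coded⇒¬decided : ∀ {x} → Coded x → ¬ Decided x
  coded⇒¬decided {x} coded (n , t , inj₁ eq)
    with trans (sym (coded⇒main coded n)) (run-const (λ _ → refl) x {n} (n≤block n) eq)
  ... | ()
  coded⇒¬decided {x} coded (n , t , inj₂ eq)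
    with trans (sym (coded⇒main coded n)) (run-const (λ _ → refl) x {n} (n≤block n) eq)
  ... | ()

  -- A point of A that extends the longest prefix of t with extensions in A
  -- (junk if A is empty).
  aim : List Bool → Cantor
  aim t with em {Meets t}
  aim t       | yes (z , _) = z
  aim []      | no _        = λ _ → false
  aim (_ ∷ t) | no _        = aim t

  aim-A : Meets [] → ∀ t → A (aim t)
  aim-A meets t with em {Meets t}
  aim-A meets t       | yes (_ , _ , Az) = Az
  aim-A meets []      | no ¬meets = contradiction meets ¬meets
  aim-A meets (_ ∷ t) | no _      = aim-A meets t

  aim-near : ∀ {s t} → Meets s → t ≽ s → Nʳ s (aim t)
  aim-near {s} {t} meets t≽s with em {Meets t}
  aim-near meets t≽s       | yes (_ , z∈t , _) = Nʳ-≽ t≽s z∈t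
  aim-near meets ≽-refl    | no ¬meets = contradiction meets ¬meets
  aim-near {t = _ ∷ _} meets (≽-∷ t≽s) | no _ = aim-near meets t≽s

  miss : List Bool → Cantor
  miss t with em {∃[ z ] Nʳ t z × ¬ A z}
  ... | yes (z , _) = z
  ... | no _        = λ _ → false

  miss-spec : ∀ {t} → ¬ Inside t → Nʳ t (miss t) × ¬ A (miss t)
  miss-spec {t} ¬inside with em {∃[ z ] Nʳ t z × ¬ A z}
  ... | yes (_ , z∈ , ¬Az) = z∈ , ¬Az
  ... | no none = contradiction (λ z z∈t → decidable-stable em (λ ¬Az → none (z , z∈t , ¬Az))) ¬inside

  level≡0-below : ∀ {s t} → ¬ Meets s → level s ≡ 0 → t ≽ s → level t ≡ 0
  level≡0-below ¬meets ℓ≡0 ≽-refl = ℓ≡0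
  level≡0-below {s} ¬meets ℓ≡0 (≽-∷ {t} {b = b} t≽s) = level-∷≡0 {b}
    (λ (z , z∈t , Az) → ¬meets (z , Nʳ-≽ {z = z} t≽s z∈t , Az)) (level≡0-below ¬meets ℓ≡0 t≽s)

  invalid-below : ∀ {s t} → ¬ Meets s → level s ≡ 0 → t ≽ s → ¬ Valid (good t)
  invalid-below {s} {t} ¬meets ℓ≡0 t≽s (inj₁ inside) =
    let z , z∈t = Nʳ-nonempty t in ¬meets (z , Nʳ-≽ {z = z} t≽s z∈t , inside z z∈t)
  invalid-below ¬meets ℓ≡0 t≽s (inj₂ 0<ℓ) = ℕ.<⇒≢ 0<ℓ (sym (level≡0-below ¬meets ℓ≡0 t≽s))

  -- The root has level 0, so if `A` were empty no good state could be valid. Hence `aim` never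
  -- returns junk at a good state that is reached.
  valid⇒meets : ∀ {t} → Valid (good t) → Meets []
  valid⇒meets {t} valid = decidable-stable em λ ¬meets → invalid-below ¬meets refl (≽-[] t) valid

  retract : Cantor → Cantor
  retract x with em {Decided x}
  ... | yes (_ , t , inj₁ _) = aim t
  ... | yes (_ , t , inj₂ _) = miss t
  ... | no _                 = decode x

  retract-good : ∀ x n {t} → run (x ↾ n) ≡ good t → retract x ≡ aim t
  retract-good x n eq with em {Decided x}
  ... | no ¬dec = contradiction (n , _ , inj₁ eq) ¬dec
  ... | yes (m , _ , inj₁ eq′) = cong (aim ∘ tag) (absorbing-unique x m n (λ _ → refl) (λ _ → refl) eq′ eq)
  ... | yes (m , _ , inj₂ eq′) with absorbing-unique x m n (λ _ → refl) (λ _ → refl) eq′ eq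
  ...   | ()

  retract-bad : ∀ x n {t} → run (x ↾ n) ≡ bad t → retract x ≡ miss t
  retract-bad x n eq with em {Decided x}
  ... | no ¬dec = contradiction (n , _ , inj₂ eq) ¬dec
  ... | yes (m , _ , inj₂ eq′) = cong (miss ∘ tag) (absorbing-unique x m n (λ _ → refl) (λ _ → refl) eq′ eq)
  ... | yes (m , _ , inj₁ eq′) with absorbing-unique x m n (λ _ → refl) (λ _ → refl) eq′ eq
  ...   | ()

  retract-coded : ∀ {x} → ¬ Decided x → retract x ≡ decode x
  retract-coded {x} ¬dec with em {Decided x}
  ... | yes dec = contradiction dec ¬dec
  ... | no _    = refl

  run-valid-at : ∀ x n {q} → run (x ↾ n) ≡ q → Valid q
  run-valid-at x n eq = subst Valid eq (run-valid x n)

  -- If `y ⇂ m` has an extension in `A`, aiming from below it stays below it. Otherwise all guesses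
  -- are refuted, the level falls to 0 at some later `k`, and no valid good state occurs below
  -- `y ⇂ k`.
  aim-eventually-near : ∀ y m → ∃[ k ] m ℕ.≤ k × (∀ {t} → t ≽ (y ⇂ k) → Valid (good t) → Nʳ (y ⇂ m) (aim t))
  aim-eventually-near y m with em {Meets (y ⇂ m)} | level (y ⇂ m) in eq
  ... | yes meets | _ = m , ℕ.≤-refl , λ t≽ _ → aim-near meets t≽
  ... | no ¬meets | zero = m , ℕ.≤-refl , λ t≽ valid → contradiction valid (invalid-below ¬meets eq t≽)
  ... | no ¬meets | suc _ with drop y (subst (0 ℕ.<_) (sym eq) (s≤s z≤n)) (λ (z , z∈ , Az , _) → ¬meets (z , z∈ , Az))
  ...   | k , m≤k , ℓ≡0 , _ = k , m≤k , λ t≽ valid → contradiction valid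
    (invalid-below (λ (z , z∈ , Az) → ¬meets (z , Nʳ-≽ {z = z} (⇂-≽ y m≤k) z∈ , Az)) ℓ≡0 t≽)

  retract-continuous : Continuous retract
  retract-continuous = locally-determined⇒continuous local
    where
    local : ∀ x m → ∃[ n ] (∀ z → z ↾ n ≡ x ↾ n → retract z ↾ m ≡ retract x ↾ m)
    local x m with em {Decided x}
    ... | yes (n , t , inj₁ eq) = n , λ z z≡x →
      cong (_↾ m) (retract-good z n (trans (cong run z≡x) eq))
    ... | yes (n , t , inj₂ eq) = n , λ z z≡x →
      cong (_↾ m) (retract-bad z n (trans (cong run z≡x) eq))
    -- Near a code three kinds of points occur: good ones are handled by `near`, bad ones are sent
    -- to extensions of their tag, and codes are decoded.
    ... | no ¬dec with aim-eventually-near (decode x) m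
    ... | k , m≤k , near = block k , λ z z≡x →
      ⇂⇒↾ m (trans (cong (retract z ⇂_) (sym (length-applyDownFrom y m))) (close z (trans (cong run z≡x) (coded⇒main (¬decided⇒coded ¬dec) k))))
      where
      y : Cantor
      y = decode x
      close : ∀ z → run (z ↾ block k) ≡ main (y ⇂ k) → Nʳ (y ⇂ m) (retract z)
      close z at with em {Decided z}
      ... | yes (n , t , inj₁ eq) = near
        (subst (λ q → t ≽ tag q) at (absorbing-tag z (block k) n (λ _ → refl) eq)) (run-valid-at z n eq)
      ... | yes (n , t , inj₂ eq) = Nʳ-≽
        (≽-trans (subst (λ q → t ≽ tag q) at (absorbing-tag z (block k) n (λ _ → refl) eq)) (⇂-≽ y m≤k))
        (proj₁ (miss-spec (run-valid-at z n eq)))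
      ... | no ¬dec = Nʳ-≽ {z = decode z} (⇂-≽ y m≤k)
        (subst (λ t → Nʳ t (decode z)) (cong tag (trans (sym (coded⇒main (¬decided⇒coded ¬dec) k)) at)) (Nʳ-⇂ (decode z) k))

  ΦC≤A : Φ C ≤W A
  ΦC≤A = retract , retract-continuous , (to ∘ ΦC⇒target) , from
    where
    to : Target ⊆ (A ∘ retract)
    to {x} (inj₁ (n , t , eq)) = subst A (sym (retract-good x n eq)) (aim-A (valid⇒meets (run-valid-at x n eq)) t)
    to {x} (inj₂ (coded , Ay)) = subst A (sym (retract-coded (coded⇒¬decided coded))) Ay
    from : (A ∘ retract) ⊆ Φ C
    from {x} Ar with em {Decided x}
    ... | yes (n , t , inj₁ eq) = ΦU⊆ΦC (U⇒ΦU (n , t , eq))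
    ... | yes (n , t , inj₂ eq) = contradiction Ar (proj₂ (miss-spec (run-valid-at x n eq)))
    ... | no ¬dec = ΦU⊆ΦC (coded-A⇒ΦU (¬decided⇒coded ¬dec) Ar)

theorem1p4 : ExcludedMiddle 0ℓ →
    ∀ (A : Pred Cantor 0ℓ) → IsΔ⁰₃ A →
    Σ[ U ∈ Pred Cantor 0ℓ ] Σ[ C ∈ Pred Cantor 0ℓ ]
    (IsOpen U × IsClosed C × Φ U ≐ Φ C × Φ C ≡W A)
theorem1p4 em A ((F , F-Fσ , A⊆⋂F , ⋂F⊆A) , _) =
  U , C , U-open , C-closed , (ΦU⊆ΦC , target⇒ΦU ∘ ΦC⇒target) , ΦC≤A , A≤ΦC
  where
  K : ℕ → ℕ → Pred Cantor 0ℓ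
  K n = proj₁ (F-Fσ n)
  K-closed : ∀ n m → IsClosed (K n m)
  K-closed n = proj₁ (proj₂ (F-Fσ n))
  A⇒K : ∀ {y} → A y → ∀ n → ∃[ m ] K n m y
  A⇒K Ay n = proj₁ (proj₂ (proj₂ (F-Fσ n))) (A⊆⋂F Ay n)
  K⇒A : ∀ {y} → (∀ n → ∃[ m ] K n m y) → A y
  K⇒A Ky = ⋂F⊆A λ n → proj₂ (proj₂ (proj₂ (F-Fσ n))) (Ky n)
  open Construction em A K K-closed A⇒K K⇒A
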